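{- Let $I$ be a finite set and let $H$ be a hypergraph over $I$. Then for every nonnegative integer $n$: (1) $\chi_I(H)(n)$ is the number of colorings $S: I\to[n]$ of $H$ such that every nonempty edge of $H$ has exactly one maximal vertex for $S$. (2) $\chi_I(H)(n)$ is also the number of pairs $(f,S)$ where $f$ is an acyclic orientation of $H$, $S$ is a coloring of $H$ with $[n]$, and $f$ and $S$ are strictly compatible. (3) For $f\in\mathcal{A}_H$, let $f(H)\subseteq I$ be the image of $f$ and let $P_{H,f}$ be the set of compositions $P$ of $f(H)$ such that for every nonempty edge $e\in H$ and every $v\in (e\setminus\{f(e)\})\cap f(H)$ one has $P(v)<P(f(e))$. For $P=(P_1,\dots,P_{l(P)})\in P_{H,f}$ define recursively $$\tilde P_i=\Big(\bigcup_{e\in f^{ -1}(P_i)} e\Big)\cap (I\setminus f(H))\cap\bigcap_{j<i}(I\setminus\tilde P_j),\qquad p_i=|\tilde P_i|,\qquad 1\le i\le l(P).$$ Let $J_H\subseteq I$ be the set of isolated vertices of $H$, i.e. vertices belonging to no edge of $H$. Then $$\chi_I(H)(n)=n^{|J_H|}\sum_{f\in\mathcal{A}_H}\ \sum_{P\in P_{H,f}}F_{p_1,\dots,p_{l(P)}}(n).$$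
   Context: Notation: $[n]=\{1,\dots,n\}$. A decomposition of a finite set $I$ of length $n$ is a sequence $(S_1,\dots,S_n)$ of pairwise disjoint (possibly empty) sets with union $I$; a composition is a decomposition with no empty part, and $l(P)$ denotes its length. A decomposition $S$ of length $n$ is identified with the function $S:I\to[n]$ with $S(v)=i$ iff $v\in S_i$; compositions correspond to surjections. Hypergraphs. A hypergraph $H$ over a finite set $I$ is a finite multiset of (possibly repeated) subsets of $I$, called edges, containing $\emptyset$ exactly once. Elements of $I$ are vertices. For $I=S\sqcup T$, the restriction $H_{|S}$ is the multiset $\{e\in H: e\subseteq S\}$ (a hypergraph over $S$) and the contraction $H_{/S}$ is the multiset $\{e\cap T: e\in H,\ e\nsubseteq S\}\cup\{\emptyset\}$ (a hypergraph over $T$), multiplicities being kept. The Hopf monoid of hypergraphs has product given by union of edges ($H_1\otimes H_2\mapsto H_1\sqcup H_2$, with $\emptyset$ kept once) and coproduct $\Delta_{S,T}(H)=H_{|S}\otimes H_{/S}$. The iterated coproduct along a decomposition $(S_1,\dots,S_n)$ of $I$ is $\Delta_{S_1,\dots,S_n}(H)=H_1\otimes\cdots\otimes H_n$ with $H_i=(H_{|S_1\sqcup\cdots\sqcup S_i})_{/S_1\sqcup\cdots\sqcup S_{i-1}}$. Basic invariant. A hypergraph is discrete if all its edges have cardinality at most $1$. Let $\zeta(H)=1$ if $H$ is discrete and $\zeta(H)=0$ otherwise. For a nonnegative integer $n$, $$\chi_I(H)(n)=\sum_{(S_1,\dots,S_n)}\zeta(H_1)\cdots\zeta(H_n),$$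 the sum being over all decompositions of $I$ of length $n$, with $\Delta_{S_1,\dots,S_n}(H)=H_1\otimes\cdots\otimes H_n$. (For $n=0$ this is $1$ if $I=\emptyset$ and $0$ otherwise.) It is known that $\chi_I(H)(n)$ is a polynomial in $n$. Colorings and orientations. A coloring of $H$ with $[n]$ is a function $S:I\to[n]$. A vertex $v\in e$ is a maximal vertex of the edge $e$ for $S$ if $S(v)=\max S(e)$. An orientation of $H$ is a function $f$ assigning to each nonempty edge $e$ of $H$ (repeated edges being treated as distinct elements) a vertex $f(e)\in e$. A directed cycle of $f$ is a sequence of distinct edges $e_1,\dots,e_k$ with $f(e_1)\in e_2\setminus\{f(e_2)\},\dots,f(e_{k-1})\in e_k\setminus\{f(e_k)\},\ f(e_k)\in e_1\setminus\{f(e_1)\}$. The orientation is acyclic if it has no directed cycle, and $\mathcal{A}_H$ is the set of acyclic orientations of $H$. An orientation $f$ and a coloring $S$ are strictly compatible if, for every nonempty edge $e$, $f(e)$ is the unique maximal vertex of $e$ for $S$. The functions $F$. For nonnegative integers $p_1,\dots,p_t$ and $n\in\mathbb{N}$, $$F_{p_1,\dots,p_t}(n)=\sum_{0\le k_1<\cdots<k_t\le n-1}k_1^{p_1}\cdots k_t^{p_t},$$ with $0^0=1$, and $F=1$ for the empty sequence ($t=0$). -}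

module Defs where

open import Data.Bool using (if_then_else_)
import Data.Bool.Properties as Bool
open import Data.Empty using (⊥-elim)
open import Data.Fin as Fin using (Fin; toℕ; fromℕ<)
import Data.Fin.Properties as Fin
open import Data.Fin.Subset
open import Data.Fin.Subset.Properties
open import Data.List as List using (List; []; _∷_; _∷ʳ_; length; filter; allFin; upTo; cartesianProductWith)
import Data.List.Membership.Propositional as List
open import Data.List.Membership.Propositional.Properties using (∈-cartesianProductWith⁺; ∈-allFin; ∈-lookup)
import Data.List.Properties as List
open import Data.List.Relation.Unary.All as All using (All; []; _∷_)
import Data.List.Relation.Unary.All.Properties as All
open import Data.List.Relation.Unary.AllPairs using ([]; _∷_)
open import Data.List.Relation.Unary.Any as Any using (Any; here)
open import Data.List.Relation.Unary.Linked using (Linked; linked?)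
open import Data.List.Relation.Unary.Unique.Propositional using (Unique)
import Data.List.Relation.Unary.Unique.DecPropositional as UniqueDec
open import Data.Nat as ℕ using (ℕ; zero; suc; _^_; _≤_; _<_)
open import Data.Nat.ListAction using (sum; product)
open import Data.Product using (∃; ∃₂; ∃!; _×_; _,_)
open import Data.Vec as Vec using (Vec; []; _∷_; lookup; toList; fromList)
import Data.Vec.Properties as Vec
import Data.Vec.Relation.Unary.All as VecAll
import Data.Vec.Relation.Unary.AllPairs as VecAllPairs
import Data.Vec.Relation.Unary.Linked as VecLinked
open import Function using (_∘_)
open import Relation.Binary.PropositionalEquality using (_≡_; refl; sym; trans; cong; subst)
open import Relation.Nullary using (Dec; yes; no; ¬_; ¬?; does; contradiction)
open import Relation.Nullary.Decidable using (map′; _×-dec_; _→-dec_)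
open import Relation.Unary using (Decidable)

-- All vectors of length n with entries in xs; each occurs exactly once
-- when xs is free of repetitions.
vecs : {A : Set} → List A → (n : ℕ) → List (Vec A n)
vecs xs zero    = [] ∷ []
vecs xs (suc n) = cartesianProductWith _∷_ xs (vecs xs n)

subsets : (m : ℕ) → List (Subset m)
subsets m = vecs (inside ∷ outside ∷ []) m

_≟ˢ_ : {m : ℕ} (p q : Subset m) → Dec (p ≡ q)
_≟ˢ_ = Vec.≡-dec Bool._≟_

occurrences : {m : ℕ} → Subset m → List (Subset m) → ℕ
occurrences p ps = length (filter (_≟ˢ p) ps)

-- Multisets of edges are lists: every construction below keeps
-- multiplicities and treats repeated edges as distinct positions.
record Hypergraph {m : ℕ} (I : Subset m) : Set where
  constructor hypergraph
  field
    edges  : List (Subset m)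
    over   : All (_⊆ I) edges
    ∅-once : occurrences ⊥ edges ≡ 1

open Hypergraph public

private
  filter-⊥ : {m : ℕ} {P : Subset m → Set} (P? : Decidable P) → P ⊥ →
             (es : List (Subset m)) → occurrences ⊥ (filter P? es) ≡ occurrences ⊥ es
  filter-⊥ P? P⊥ []       = refl
  filter-⊥ P? P⊥ (e ∷ es) with P? e | e ≟ˢ ⊥ in eq
  ... | yes _  | yes _ rewrite eq = cong suc (filter-⊥ P? P⊥ es)
  ... | yes _  | no  _ rewrite eq = filter-⊥ P? P⊥ es
  ... | no ¬Pe | yes refl         = contradiction P⊥ ¬Pe
  ... | no _   | no _             = filter-⊥ P? P⊥ es

  ∩─-≢⊥ : {m : ℕ} {I S e : Subset m} → e ⊆ I → ¬ (e ⊆ S) → ¬ (e ∩ (I ─ S) ≡ ⊥)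
  ∩─-≢⊥ {I = I} {S} {e} e⊆I e⊈S eq = e⊈S e⊆S
    where
    e⊆S : e ⊆ S
    e⊆S {v} v∈e with v ∈? S
    ... | yes v∈S = v∈S
    ... | no  v∉S = ⊥-elim (∉⊥ (subst (v ∈_) eq
                      (x∈p∩q⁺ (v∈e , x∈p∧x∉q⇒x∈p─q (e⊆I v∈e) v∉S))))

  contract-nonempty : {m : ℕ} {I : Subset m} (S : Subset m) {es : List (Subset m)} →
                      All (_⊆ I) es →
                      All (λ e → ¬ (e ∩ (I ─ S) ≡ ⊥)) (filter (λ e → ¬? (e ⊆? S)) es)
  contract-nonempty S []                      = []
  contract-nonempty S {e ∷ es} (e⊆I ∷ es⊆I) with e ⊆? S
  ... | yes _  = contract-nonempty S es⊆I
  ... | no e⊈S = ∩─-≢⊥ e⊆I e⊈S ∷ contract-nonempty S es⊆I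

  occurrences-none : {m : ℕ} {p : Subset m} {es : List (Subset m)} →
                     All (λ e → ¬ (e ≡ p)) es → occurrences p es ≡ 0
  occurrences-none {p = p} = cong length ∘ List.filter-none (_≟ˢ p)

restrict : {m : ℕ} {I : Subset m} → Hypergraph I → (S : Subset m) → Hypergraph S
restrict H S .edges  = filter (_⊆? S) (edges H)
restrict H S .over   = All.all-filter (_⊆? S) (edges H)
restrict H S .∅-once = trans (filter-⊥ (_⊆? S) (⊆-min S) (edges H)) (∅-once H)

contract : {m : ℕ} {I : Subset m} → Hypergraph I → (S : Subset m) → Hypergraph (I ─ S)
contract {I = I} H S .edges  =
  ⊥ ∷ List.map (_∩ (I ─ S)) (filter (λ e → ¬? (e ⊆? S)) (edges H))
contract {I = I} H S .over   =
  ⊆-min (I ─ S) ∷ All.map⁺ (All.universal (λ e {_} → p∩q⊆q e (I ─ S)) _)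
contract {I = I} H S .∅-once =
  trans (cong length (List.filter-accept (_≟ˢ ⊥) {x = ⊥}
      {xs = List.map (_∩ (I ─ S)) (filter (λ e → ¬? (e ⊆? S)) (edges H))} refl))
    (cong suc (occurrences-none (All.map⁺ (contract-nonempty S (over H)))))

-- The i-th tensor factor of the iterated coproduct of H along S.  Since i
-- counts from 0, "take i" collects exactly the parts before the i-th one.
factor : {m n : ℕ} {I : Subset m} → Hypergraph I → (S : Vec (Subset m) n) (i : Fin n) →
         Hypergraph (⋃ (List.take (suc (toℕ i)) (toList S)) ─ ⋃ (List.take (toℕ i) (toList S)))
factor H S i = contract (restrict H (⋃ (List.take (suc (toℕ i)) (toList S))))
                        (⋃ (List.take (toℕ i) (toList S)))

Disjoint : {m : ℕ} → Subset m → Subset m → Set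
Disjoint p q = Empty (p ∩ q)

IsDecomposition : {m n : ℕ} → Subset m → Vec (Subset m) n → Set
IsDecomposition I S = VecAllPairs.AllPairs Disjoint S × ⋃ (toList S) ≡ I

isDecomposition? : {m n : ℕ} (I : Subset m) → Decidable (IsDecomposition {n = n} I)
isDecomposition? I S =
  VecAllPairs.allPairs? (λ p q → ¬? (nonempty? (p ∩ q))) S ×-dec (⋃ (toList S) ≟ˢ I)

IsComposition : {m l : ℕ} → Subset m → Vec (Subset m) l → Set
IsComposition I P = IsDecomposition I P × VecAll.All Nonempty P

isComposition? : {m l : ℕ} (I : Subset m) → Decidable (IsComposition {l = l} I)
isComposition? I P = isDecomposition? I P ×-dec VecAll.all? nonempty? P

decompositions : {m : ℕ} → Subset m → (n : ℕ) → List (Vec (Subset m) n)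
decompositions {m} I n = filter (isDecomposition? I) (vecs (subsets m) n)

-- Disjoint nonempty parts of I number at most ∣ I ∣, so no length is missed.
compositions : {m : ℕ} → Subset m → List (∃ λ l → Vec (Subset m) l)
compositions {m} I = List.concatMap
  (λ l → List.map (l ,_) (filter (isComposition? I) (vecs (subsets m) l)))
  (upTo (suc ∣ I ∣))

Discrete : {m : ℕ} {I : Subset m} → Hypergraph I → Set
Discrete H = All (λ e → ∣ e ∣ ≤ 1) (edges H)

discrete? : {m : ℕ} {I : Subset m} → Decidable (Discrete {I = I})
discrete? H = All.all? (λ e → ∣ e ∣ ℕ.≤? 1) (edges H)

ζ : {m : ℕ} {I : Subset m} → Hypergraph I → ℕ
ζ H = if does (discrete? H) then 1 else 0

χ : {m : ℕ} {I : Subset m} → Hypergraph I → ℕ → ℕ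
χ {I = I} H n = sum (List.map
  (λ S → product (List.map (λ i → ζ (factor H S i)) (allFin n)))
  (decompositions I n))

Coloring : ℕ → ℕ → Set
Coloring m n = Vec (Fin n) m

colorings : (m n : ℕ) → List (Coloring m n)
colorings m n = vecs (allFin n) m

Maximal : {m n : ℕ} → Coloring m n → Subset m → Fin m → Set
Maximal S e v = v ∈ e × (∀ w → w ∈ e → lookup S w Fin.≤ lookup S v)

maximal? : {m n : ℕ} (S : Coloring m n) (e : Subset m) → Decidable (Maximal S e)
maximal? S e v = v ∈? e ×-dec Fin.all? (λ w → w ∈? e →-dec lookup S w Fin.≤? lookup S v)

UniqueMaximal : {m n : ℕ} → Coloring m n → Subset m → Fin m → Set
UniqueMaximal S e v = Maximal S e v × (∀ {w} → Maximal S e w → v ≡ w)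

uniqueMaximal? : {m n : ℕ} (S : Coloring m n) (e : Subset m) → Decidable (UniqueMaximal S e)
uniqueMaximal? S e v = maximal? S e v ×-dec
  map′ (λ h {w} → h w) (λ h w → h {w}) (Fin.all? (λ w → maximal? S e w →-dec v Fin.≟ w))

-- The vertex set of H is all of Fin m here.
module _ {m : ℕ} (H : Hypergraph {m} ⊤) where

  nonemptyEdges : List (Subset m)
  nonemptyEdges = filter nonempty? (edges H)

  -- Edges are positions in the list, so that repeated edges stay distinct.
  Edge : Set
  Edge = Fin (length nonemptyEdges)

  vertices : Edge → Subset m
  vertices = List.lookup nonemptyEdges

  HasUniqueMaxima : {n : ℕ} → Coloring m n → Set
  HasUniqueMaxima S = ∀ e → ∃! _≡_ (Maximal S (vertices e))

  hasUniqueMaxima? : {n : ℕ} → Decidable (HasUniqueMaxima {n})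
  hasUniqueMaxima? S = Fin.all? (λ e → Fin.any? (uniqueMaximal? S (vertices e)))

  isolated : Subset m
  isolated = ∁ (⋃ (edges H))

  Assignment : Set
  Assignment = Vec (Fin m) (length nonemptyEdges)

  IsOrientation : Assignment → Set
  IsOrientation f = ∀ e → lookup f e ∈ vertices e

  isOrientation? : Decidable IsOrientation
  isOrientation? f = Fin.all? (λ e → lookup f e ∈? vertices e)

  Arc : Assignment → Edge → Edge → Set
  Arc f e e′ = lookup f e ∈ vertices e′ - lookup f e′

  -- The cyclic sequence e₁, e₂, …, eₖ is e ∷ es.
  DirectedCycle : Assignment → Edge → List Edge → Set
  DirectedCycle f e es = Unique (e ∷ es) × Linked (Arc f) (e ∷ es ∷ʳ e)

  Acyclic : Assignment → Set
  Acyclic f = ¬ (∃₂ λ e es → DirectedCycle f e es)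

  StrictlyCompatible : {n : ℕ} → Assignment → Coloring m n → Set
  StrictlyCompatible f S = ∀ e → UniqueMaximal S (vertices e) (lookup f e)

  strictlyCompatible? : {n : ℕ} (f : Assignment) → Decidable (StrictlyCompatible {n} f)
  strictlyCompatible? f S = Fin.all? (λ e → uniqueMaximal? S (vertices e) (lookup f e))

  private
    ∈-vecs : {A : Set} {xs : List A} → (∀ x → x List.∈ xs) → {n : ℕ} (v : Vec A n) → v List.∈ vecs xs n
    ∈-vecs all []      = here refl
    ∈-vecs all (x ∷ v) = ∈-cartesianProductWith⁺ _∷_ (all x) (∈-vecs all v)

    unique⇒injective : {A : Set} {xs : List A} → Unique xs →
                       {i j : Fin (length xs)} → List.lookup xs i ≡ List.lookup xs j → i ≡ j
    unique⇒injective (_  ∷ _)  {Fin.zero}  {Fin.zero}  _  = refl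
    unique⇒injective (p  ∷ _)  {Fin.zero}  {Fin.suc j} eq = contradiction eq (All.lookup p (∈-lookup j))
    unique⇒injective (p  ∷ _)  {Fin.suc i} {Fin.zero}  eq = contradiction (sym eq) (All.lookup p (∈-lookup i))
    unique⇒injective (_  ∷ u)  {Fin.suc i} {Fin.suc j} eq = cong Fin.suc (unique⇒injective u eq)

    unique-length : {k : ℕ} {xs : List (Fin k)} → Unique xs → length xs ≤ k
    unique-length u = Fin.injective⇒≤ (unique⇒injective u)

  directedCycle? : (f : Assignment) (e : Edge) → Decidable (DirectedCycle f e)
  directedCycle? f e es = UniqueDec.unique? Fin._≟_ (e ∷ es) ×-dec
    linked? (λ e₁ e₂ → lookup f e₁ ∈? vertices e₂ - lookup f e₂) (e ∷ es ∷ʳ e)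

  -- A directed cycle has at most as many edges as H, so finitely many
  -- sequences need to be inspected.
  acyclic? : Decidable Acyclic
  acyclic? f = ¬? (map′ to from (Fin.any? λ e → Fin.any? λ k → search e (toℕ k)))
    where
    Bounded : Edge → ℕ → Set
    Bounded e k = Any (DirectedCycle f e ∘ toList) (vecs (allFin (length nonemptyEdges)) k)

    search : ∀ e k → Dec (Bounded e k)
    search e k = Any.any? (directedCycle? f e ∘ toList) (vecs (allFin (length nonemptyEdges)) k)

    to : (∃₂ λ e (k : Edge) → Bounded e (toℕ k)) → ∃₂ λ e es → DirectedCycle f e es
    to (e , k , b) with Any.satisfied b
    ... | v , c = e , toList v , c

    from : (∃₂ λ e es → DirectedCycle f e es) → ∃₂ λ e (k : Edge) → Bounded e (toℕ k)
    from (e , es , c@(u , _)) = e , fromℕ< len ,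
      subst (Bounded e) (sym (Fin.toℕ-fromℕ< len))
        (Any.map (λ { refl → subst (DirectedCycle f e) (sym (Vec.toList∘fromList es)) c })
          (∈-vecs ∈-allFin (fromList es)))
      where
      len : length es < length nonemptyEdges
      len = unique-length u

  acyclicOrientations : List Assignment
  acyclicOrientations = filter acyclic?
    (filter isOrientation? (vecs (allFin m) (length nonemptyEdges)))

  image : Assignment → Subset m
  image f = ⋃ (List.map ⁅_⁆ (toList f))

  -- P is read as a function on image f: P(v) = i iff v ∈ lookup P i.
  Respects : {l : ℕ} → Assignment → Vec (Subset m) l → Set
  Respects f P = ∀ e v → v ∈ (vertices e - lookup f e) ∩ image f →
    ∀ i j → v ∈ lookup P i → lookup f e ∈ lookup P j → i Fin.< j

  respects? : {l : ℕ} (f : Assignment) → Decidable (Respects {l} f)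
  respects? f P = Fin.all? λ e → Fin.all? λ v →
    v ∈? (vertices e - lookup f e) ∩ image f →-dec
    Fin.all? λ i → Fin.all? λ j →
    v ∈? lookup P i →-dec (lookup f e ∈? lookup P j →-dec i Fin.<? j)

  compatibleCompositions : Assignment → List (∃ λ l → Vec (Subset m) l)
  compatibleCompositions f = filter (λ (_ , P) → respects? f P) (compositions (image f))

  -- The sets P̃ᵢ; "earlier" lists the P̃ⱼ with j < i.
  tildes : {l : ℕ} → Assignment → List (Subset m) → Vec (Subset m) l → Vec (Subset m) l
  tildes f earlier []      = []
  tildes f earlier (p ∷ P) = p̃ ∷ tildes f (p̃ ∷ earlier) P
    where
    p̃ : Subset m
    p̃ = ⋃ (List.map vertices (filter (λ e → lookup f e ∈? p) (allFin (length nonemptyEdges))))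
          ∩ ∁ (image f) ∩ ⋂ (List.map ∁ earlier)

  exponents : {l : ℕ} → Assignment → Vec (Subset m) l → Vec ℕ l
  exponents f P = Vec.map ∣_∣ (tildes f [] P)

F : {t : ℕ} → Vec ℕ t → ℕ → ℕ
F {t} ps n = sum (List.map
  (λ ks → product (toList (Vec.zipWith _^_ (Vec.map toℕ ks) ps)))
  (filter (VecLinked.linked? Fin._<?_) (vecs (allFin n) t)))

{-# OPTIONS --safe #-}

-- Every count is a sum of 0/1 indicators over a list without repetitions, and
-- two counts agree by exchanging a double sum in which each object of either
-- side has exactly one partner.
--
-- (1) A decomposition is a coloring S.  A nonempty edge e contributes to the
-- i-th factor exactly when i = max S(e), and there it becomes its set of
-- maximal vertices.
-- (2) The only orientation strictly compatible with S picks the maximal vertex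
-- of each edge; it is acyclic because colors increase along its arcs.
-- (3) A coloring S strictly compatible with f splits f(H) into its level sets
-- P₁, …, Pₗ, with values k₁ < ⋯ < kₗ.  Given P ∈ P_{H,f} and k, what remains to
-- be satisfied is S(v) < kᵢ for v ∈ P̃ᵢ, because Pᵢ is the lowest level that
-- constrains v.  As colors start at 0, this leaves kᵢ choices for each such v,
-- and n for each isolated vertex.
module Submission where

open import Defs
open import Data.Bool using (if_then_else_; true; false)
open import Data.Empty using (⊥-elim)
open import Data.Fin as Fin using (Fin; toℕ)
import Data.Fin.Properties as Fin
open import Data.Fin.Subset
open import Data.Fin.Subset.Properties
open import Data.List as List
  using (List; []; _∷_; _++_; _∷ʳ_; length; filter; map; concatMap; cartesianProductWith; cartesianProduct; allFin)
open import Data.List.Membership.Propositional using (find) renaming (_∈_ to _∈ˡ_)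
open import Data.List.Membership.Propositional.Properties
  using (∈-cartesianProductWith⁺; ∈-map⁺; ∈-map⁻; ∈-filter⁺; ∈-filter⁻; ∈-lookup; ∈-allFin; ∈-upTo⁺;
         ∈-concatMap⁺; ∈-concatMap⁻)
import Data.List.Properties as List
open import Data.List.Relation.Unary.All as All using (All; []; _∷_)
import Data.List.Relation.Unary.All.Properties as All
open import Data.List.Relation.Unary.AllPairs as AllPairs using ([]; _∷_)
import Data.List.Relation.Unary.AllPairs.Properties as AllPairs
open import Data.List.Relation.Unary.Any as Any using (here; there)
import Data.List.Relation.Unary.Any.Properties as Any
open import Data.List.Relation.Unary.Linked using (Linked; []; [-]; _∷_)
import Data.List.Relation.Unary.Linked.Properties as Linked
open import Data.List.Relation.Unary.Unique.Propositional using (Unique)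
import Data.List.Relation.Unary.Unique.Propositional.Properties as Unique
open import Data.Nat as ℕ using (ℕ; zero; suc; _+_; _*_; _^_; _≤_; _<_; z≤n; s≤s)
open import Data.Nat.ListAction using (sum; product)
open import Data.Nat.ListAction.Properties using (sum-++)
import Data.Nat.Properties as ℕ
open import Algebra.Properties.CommutativeMonoid.Sum ℕ.*-1-commutativeMonoid
  using () renaming (sum to ∏; sum-cong-≗ to ∏-cong; ∑-distrib-+ to ∏-distrib-*; ∑-comm to ∏-comm)
open import Algebra.Properties.CommutativeSemigroup ℕ.+-commutativeSemigroup using (x∙yz≈y∙xz)
open import Data.Product using (∃; _×_; _,_; proj₁; proj₂)
open import Data.Sum using (inj₁; inj₂)
open import Data.Vec as Vec using (Vec; []; _∷_; lookup; toList; here; there)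
import Data.Vec.Membership.Propositional as Vec
import Data.Vec.Membership.Propositional.Properties as Vec
import Data.Vec.Properties as Vec
import Data.Vec.Relation.Unary.All as VecAll
import Data.Vec.Relation.Unary.All.Properties as VecAll
open import Data.Vec.Relation.Unary.AllPairs as VecAllPairs using ([]; _∷_)
import Data.Vec.Relation.Unary.AllPairs.Properties as VecAllPairs
import Data.Vec.Relation.Unary.Any as VecAny
import Data.Vec.Relation.Unary.Any.Properties as VecAny
import Data.Vec.Relation.Unary.Linked as VecLinked
import Data.Vec.Relation.Unary.Linked.Properties as VecLinked
open import Function using (_∘_; _⇔_; mk⇔; id)
open import Relation.Binary.PropositionalEquality
open import Relation.Nullary using (Dec; yes; no; ¬_; does; contradiction)
open import Relation.Nullary.Decidable using (_×-dec_; _→-dec_; does-⇔; dec-true; dec-false)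
open import Relation.Unary using (Decidable)

private
  variable
    A B C : Set
    l m n : ℕ

-- Sums of indicators

-- Shaped like `ζ`, so that `ζ H` is `⟦ discrete? H ⟧` by definition.
⟦_⟧ : {P : Set} → Dec P → ℕ
⟦ P? ⟧ = if does P? then 1 else 0

⟦⟧-cong : {P Q : Set} (P? : Dec P) (Q? : Dec Q) → P ⇔ Q → ⟦ P? ⟧ ≡ ⟦ Q? ⟧
⟦⟧-cong P? Q? P⇔Q = cong (if_then 1 else 0) (does-⇔ P⇔Q P? Q?)

⟦⟧-yes : {P : Set} (P? : Dec P) → P → ⟦ P? ⟧ ≡ 1
⟦⟧-yes P? p = cong (if_then 1 else 0) (dec-true P? p)

⟦⟧-no : {P : Set} (P? : Dec P) → ¬ P → ⟦ P? ⟧ ≡ 0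
⟦⟧-no P? ¬p = cong (if_then 1 else 0) (dec-false P? ¬p)

⟦⟧-× : {P Q : Set} (P? : Dec P) (Q? : Dec Q) → ⟦ P? ×-dec Q? ⟧ ≡ ⟦ P? ⟧ * ⟦ Q? ⟧
⟦⟧-× P? Q? with does P? | does Q?
... | true  | true  = refl
... | true  | false = refl
... | false | _     = refl

⟦⟧-all? : ∀ {n} {R : Fin (suc n) → Set} (R? : Decidable R) →
          ⟦ Fin.all? R? ⟧ ≡ ⟦ R? Fin.zero ⟧ * ⟦ Fin.all? (R? ∘ Fin.suc) ⟧
⟦⟧-all? {R = R} R? = trans
  (⟦⟧-cong (Fin.all? R?) (R? Fin.zero ×-dec Fin.all? (R? ∘ Fin.suc))
    (mk⇔ (λ r → r Fin.zero , r ∘ Fin.suc) (λ (r₀ , r) → Fin.∀-cons {P = R} r₀ r)))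
  (⟦⟧-× (R? Fin.zero) (Fin.all? (R? ∘ Fin.suc)))

∑ : List A → (A → ℕ) → ℕ
∑ xs f = sum (map f xs)

∑-cong : (xs : List A) {f g : A → ℕ} → (∀ {x} → x ∈ˡ xs → f x ≡ g x) → ∑ xs f ≡ ∑ xs g
∑-cong []       f≡g = refl
∑-cong (x ∷ xs) f≡g = cong₂ _+_ (f≡g (here refl)) (∑-cong xs (f≡g ∘ there))

∑-zero : (xs : List A) {f : A → ℕ} → (∀ {x} → x ∈ˡ xs → f x ≡ 0) → ∑ xs f ≡ 0
∑-zero []       f≡0 = refl
∑-zero (x ∷ xs) f≡0 = cong₂ _+_ (f≡0 (here refl)) (∑-zero xs (f≡0 ∘ there))

∑-++ : (xs ys : List A) (f : A → ℕ) → ∑ (xs ++ ys) f ≡ ∑ xs f + ∑ ys f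
∑-++ xs ys f = trans (cong sum (List.map-++ f xs ys)) (sum-++ (map f xs) (map f ys))

∑-map : (g : A → B) (xs : List A) (f : B → ℕ) → ∑ (map g xs) f ≡ ∑ xs (f ∘ g)
∑-map g xs f = cong sum (sym (List.map-∘ xs))

∑-concatMap : (g : A → List B) (xs : List A) (f : B → ℕ) →
              ∑ (concatMap g xs) f ≡ ∑ xs (λ x → ∑ (g x) f)
∑-concatMap g []       f = refl
∑-concatMap g (x ∷ xs) f =
  trans (∑-++ (g x) (concatMap g xs) f) (cong (∑ (g x) f +_) (∑-concatMap g xs f))

∑-cartesianProductWith : (g : A → B → C) (xs : List A) (ys : List B) (f : C → ℕ) →
  ∑ (cartesianProductWith g xs ys) f ≡ ∑ xs (λ x → ∑ ys (λ y → f (g x y)))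
∑-cartesianProductWith g []       ys f = refl
∑-cartesianProductWith g (x ∷ xs) ys f =
  trans (∑-++ (map (g x) ys) (cartesianProductWith g xs ys) f)
        (cong₂ _+_ (∑-map (g x) ys f) (∑-cartesianProductWith g xs ys f))

∑-distrib-+ : (xs : List A) (f g : A → ℕ) → ∑ xs (λ x → f x + g x) ≡ ∑ xs f + ∑ xs g
∑-distrib-+ []       f g = refl
∑-distrib-+ (x ∷ xs) f g = begin
  f x + g x + ∑ xs (λ x → f x + g x) ≡⟨ cong (f x + g x +_) (∑-distrib-+ xs f g) ⟩
  f x + g x + (∑ xs f + ∑ xs g)      ≡⟨ ℕ.+-assoc (f x) (g x) _ ⟩
  f x + (g x + (∑ xs f + ∑ xs g))    ≡⟨ cong (f x +_) (x∙yz≈y∙xz (g x) (∑ xs f) (∑ xs g)) ⟩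
  f x + (∑ xs f + (g x + ∑ xs g))    ≡⟨ ℕ.+-assoc (f x) (∑ xs f) _ ⟨
  f x + ∑ xs f + (g x + ∑ xs g)      ∎
  where open ≡-Reasoning

∑-comm : (xs : List A) (ys : List B) (f : A → B → ℕ) →
         ∑ xs (λ x → ∑ ys (f x)) ≡ ∑ ys (λ y → ∑ xs (λ x → f x y))
∑-comm []       ys f = sym (∑-zero ys (λ _ → refl))
∑-comm (x ∷ xs) ys f =
  trans (cong (∑ ys (f x) +_) (∑-comm xs ys f)) (sym (∑-distrib-+ ys (f x) _))

*-distribˡ-∑ : (c : ℕ) (xs : List A) (f : A → ℕ) → c * ∑ xs f ≡ ∑ xs (λ x → c * f x)
*-distribˡ-∑ c []       f = ℕ.*-zeroʳ c
*-distribˡ-∑ c (x ∷ xs) f =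
  trans (ℕ.*-distribˡ-+ c (f x) _) (cong (c * f x +_) (*-distribˡ-∑ c xs f))

∑-∑-* : (xs : List A) (ys : List B) (f : A → ℕ) (g : B → ℕ) →
        ∑ xs (λ x → ∑ ys (λ y → f x * g y)) ≡ ∑ xs f * ∑ ys g
∑-∑-* []       ys f g = refl
∑-∑-* (x ∷ xs) ys f g =
  trans (cong₂ _+_ (sym (*-distribˡ-∑ (f x) ys g)) (∑-∑-* xs ys f g))
        (sym (ℕ.*-distribʳ-+ (∑ ys g) (f x) _))

length-filter : {P : A → Set} (P? : Decidable P) (xs : List A) →
                length (filter P? xs) ≡ ∑ xs (⟦_⟧ ∘ P?)
length-filter P? []       = refl
length-filter P? (x ∷ xs) with does (P? x)
... | true  = cong suc (length-filter P? xs)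
... | false = length-filter P? xs

-- Every matching of objects with partners enters through this lemma. If `P` fails, `sound` makes
-- all terms vanish; if it holds, `exists` gives a term 1, and `unique` together with the absence of
-- repetitions excludes a second one.
∑-unique : {P : Set} {R : A → Set} (R? : Decidable R) (P? : Dec P) {xs : List A} → Unique xs →
           (P → ∃ λ x → x ∈ˡ xs × R x) →
           (∀ {x} → x ∈ˡ xs → R x → P) →
           (∀ {x y} → x ∈ˡ xs → y ∈ˡ xs → R x → R y → x ≡ y) →
           ∑ xs (⟦_⟧ ∘ R?) ≡ ⟦ P? ⟧
∑-unique {R = R} R? P? {xs} xs! exists sound unique with P?
... | no ¬p = ∑-zero xs λ {x} x∈ → ⟦⟧-no (R? x) (¬p ∘ sound x∈)
... | yes p = let x , x∈ , r = exists p in go xs! x∈ r unique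
  where
  go : ∀ {xs x} → Unique xs → x ∈ˡ xs → R x →
       (∀ {x y} → x ∈ˡ xs → y ∈ˡ xs → R x → R y → x ≡ y) → ∑ xs (⟦_⟧ ∘ R?) ≡ 1
  go {x ∷ xs} (x∉ ∷ _) (here refl) r uniq = cong₂ _+_ (⟦⟧-yes (R? x) r)
    (∑-zero xs λ {y} y∈ → ⟦⟧-no (R? y) λ r′ →
      All.lookup x∉ y∈ (uniq (here refl) (there y∈) r r′))
  go {y ∷ xs} (y∉ ∷ xs!) (there x∈) r uniq = cong₂ _+_
    (⟦⟧-no (R? y) λ r′ → All.lookup y∉ x∈ (uniq (here refl) (there x∈) r′ r))
    (go xs! x∈ r λ u v → uniq (there u) (there v))

-- The last hypothesis lets an element reveal its block, so blocks of distinct indices are disjoint.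
concatMap-unique : {f : A → List B} {xs : List A} → Unique xs → (∀ x → Unique (f x)) →
                   (∀ {x y z} → z ∈ˡ f x → z ∈ˡ f y → x ≡ y) → Unique (concatMap f xs)
concatMap-unique {f = f} {xs} xs! f! sep = Unique.concat⁺
  (All.map⁺ (All.universal f! xs))
  (AllPairs.map⁺ (AllPairs.map (λ x≢y {z} (z∈fx , z∈fy) → x≢y (sep z∈fx z∈fy)) xs!))

vecs-unique : {xs : List A} → Unique xs → ∀ n → Unique (vecs xs n)
vecs-unique xs! zero    = [] ∷ []
vecs-unique xs! (suc n) = Unique.cartesianProductWith⁺ _∷_ Vec.∷-injective xs! (vecs-unique xs! n)

∈-vecs : {xs : List A} → (∀ x → x ∈ˡ xs) → ∀ {n} (v : Vec A n) → v ∈ˡ vecs xs n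
∈-vecs all []      = here refl
∈-vecs all (x ∷ v) = ∈-cartesianProductWith⁺ _∷_ (all x) (∈-vecs all v)

-- A condition imposed entry by entry lets the entries be chosen independently. This is how a count
-- of colorings becomes a product over vertices.
∑-vecs : (xs : List A) {m : ℕ} {R : Fin m → A → Set} (R? : ∀ i x → Dec (R i x)) →
         ∑ (vecs xs m) (λ v → ⟦ Fin.all? (λ i → R? i (lookup v i)) ⟧) ≡
         ∏ (λ i → ∑ xs (λ x → ⟦ R? i x ⟧))
∑-vecs xs {zero}  R? = refl
∑-vecs xs {suc m} R? = begin
  ∑ (vecs xs (suc m)) (λ v → ⟦ Fin.all? (λ i → R? i (lookup v i)) ⟧)
    ≡⟨ ∑-cartesianProductWith _∷_ xs (vecs xs m) _ ⟩
  ∑ xs (λ x → ∑ (vecs xs m) (λ v → ⟦ Fin.all? (λ i → R? i (lookup (x ∷ v) i)) ⟧))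
    ≡⟨ ∑-cong xs (λ {x} _ → ∑-cong (vecs xs m) λ {v} _ →
         ⟦⟧-all? (λ i → R? i (lookup (x ∷ v) i))) ⟩
  ∑ xs (λ x → ∑ (vecs xs m) (λ v → ⟦ R? Fin.zero x ⟧ * ⟦ Fin.all? (λ i → R? (Fin.suc i) (lookup v i)) ⟧))
    ≡⟨ ∑-∑-* xs (vecs xs m) _ _ ⟩
  ∑ xs (λ x → ⟦ R? Fin.zero x ⟧) * ∑ (vecs xs m) (λ v → ⟦ Fin.all? (λ i → R? (Fin.suc i) (lookup v i)) ⟧)
    ≡⟨ cong (∑ xs (λ x → ⟦ R? Fin.zero x ⟧) *_) (∑-vecs xs (R? ∘ Fin.suc)) ⟩
  ∏ (λ i → ∑ xs (λ x → ⟦ R? i x ⟧)) ∎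
  where open ≡-Reasoning

-- Products of powers, and counting colors

∏-one : {g : Fin l → ℕ} → (∀ i → g i ≡ 1) → ∏ g ≡ 1
∏-one {zero}  g≡1 = refl
∏-one {suc l} g≡1 = cong₂ _*_ (g≡1 Fin.zero) (∏-one (g≡1 ∘ Fin.suc))

∏-single : {g : Fin l → ℕ} (i : Fin l) → (∀ j → j ≢ i → g j ≡ 1) → ∏ g ≡ g i
∏-single {g = g} Fin.zero    g≡1 =
  trans (cong (g Fin.zero *_) (∏-one λ j → g≡1 (Fin.suc j) λ ())) (ℕ.*-identityʳ _)
∏-single {g = g} (Fin.suc i) g≡1 = trans
  (cong₂ _*_ (g≡1 Fin.zero λ ()) (∏-single i λ j j≢i → g≡1 (Fin.suc j) (j≢i ∘ Fin.suc-injective)))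
  (ℕ.*-identityˡ _)

product-toList : (v : Vec ℕ l) → product (toList v) ≡ ∏ (lookup v)
product-toList []      = refl
product-toList (x ∷ v) = cong (x *_) (product-toList v)

^-⟦⟧-yes : ∀ c {P : Set} (P? : Dec P) → P → c ^ ⟦ P? ⟧ ≡ c
^-⟦⟧-yes c P? p = trans (cong (c ^_) (⟦⟧-yes P? p)) (ℕ.^-identityʳ c)

-- This includes `c` equal to 0, in agreement with the convention 0^0 = 1: an empty P̃ᵢ at color 0
-- contributes the factor 1.
^-⟦⟧-no : ∀ c {P : Set} (P? : Dec P) → ¬ P → c ^ ⟦ P? ⟧ ≡ 1
^-⟦⟧-no c P? ¬p = cong (c ^_) (⟦⟧-no P? ¬p)

-- Spreads a power over all vertices with exponents 0 and 1, so that powers attached to different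
-- subsets can be regrouped vertex by vertex.
∏-^-∈ : ∀ c (p : Subset m) → ∏ (λ v → c ^ ⟦ v ∈? p ⟧) ≡ c ^ ∣ p ∣
∏-^-∈ c []            = refl
∏-^-∈ {suc m} c (x ∷ p) = trans (cong₂ _*_ (first x) (trans (∏-cong rest) (∏-^-∈ c p))) (count x)
  where
  first : ∀ x → c ^ ⟦ Fin.zero ∈? x ∷ p ⟧ ≡ (if x then c else 1)
  first true  = ^-⟦⟧-yes c (Fin.zero ∈? inside ∷ p) here
  first false = ^-⟦⟧-no c (Fin.zero ∈? outside ∷ p) λ ()
  rest : ∀ v → c ^ ⟦ Fin.suc v ∈? x ∷ p ⟧ ≡ c ^ ⟦ v ∈? p ⟧
  rest v = cong (c ^_) (⟦⟧-cong (Fin.suc v ∈? x ∷ p) (v ∈? p) (mk⇔ drop-there there))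
  count : ∀ x → (if x then c else 1) * c ^ ∣ p ∣ ≡ c ^ ∣ x ∷ p ∣
  count true  = refl
  count false = ℕ.*-identityˡ _

∑-allFin : (f : Fin (suc n) → ℕ) → ∑ (allFin (suc n)) f ≡ f Fin.zero + ∑ (allFin n) (f ∘ Fin.suc)
∑-allFin {n} f = cong (λ ks → f Fin.zero + sum ks)
  (trans (List.map-tabulate Fin.suc f) (sym (List.map-tabulate id (f ∘ Fin.suc))))

∑-allFin-one : {f : Fin n → ℕ} → (∀ k → f k ≡ 1) → ∑ (allFin n) f ≡ n
∑-allFin-one {zero}      _   = refl
∑-allFin-one {suc n} {f} f≡1 = trans (∑-allFin f)
  (cong₂ _+_ (f≡1 Fin.zero) (∑-allFin-one (f≡1 ∘ Fin.suc)))

-- Source of the bases kᵢ in `F`: with colors starting at 0, a vertex that must stay below color kᵢ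
-- has kᵢ choices.
#< : (c : Fin n) → ∑ (allFin n) (λ k → ⟦ k Fin.<? c ⟧) ≡ toℕ c
#< {suc n} Fin.zero    = ∑-zero (allFin (suc n)) λ {k} _ → ⟦⟧-no (k Fin.<? Fin.zero {n = n}) λ ()
#< {suc n} (Fin.suc c) = trans (∑-allFin {n} (λ k → ⟦ k Fin.<? Fin.suc c ⟧)) (cong₂ _+_
  (⟦⟧-yes (Fin.zero {n = n} Fin.<? Fin.suc c) (s≤s z≤n))
  (trans (∑-cong (allFin n) λ {k} _ →
            ⟦⟧-cong (Fin.suc k Fin.<? Fin.suc c) (k Fin.<? c) (mk⇔ ℕ.≤-pred s≤s))
         (#< c)))

-- Decompositions and colorings

product-⟦⟧ : {P : Fin n → Set} (P? : Decidable P) →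
             product (map (⟦_⟧ ∘ P?) (allFin n)) ≡ ⟦ Fin.all? P? ⟧
-- The induction runs on `tabulate`, because the tail of `allFin (suc n)` is not literally
-- `allFin n`.
product-⟦⟧ P? = trans (cong product (List.map-tabulate id (⟦_⟧ ∘ P?))) (go P?)
  where
  go : {P : Fin n → Set} (P? : Decidable P) → product (List.tabulate (⟦_⟧ ∘ P?)) ≡ ⟦ Fin.all? P? ⟧
  go {zero}  P? = refl
  go {suc n} P? = trans (cong (⟦ P? Fin.zero ⟧ *_) (go (P? ∘ Fin.suc))) (sym (⟦⟧-all? P?))

lookup-ext : {u v : Vec A n} → (∀ i → lookup u i ≡ lookup v i) → u ≡ v
lookup-ext {u = u} {v} eq =
  trans (sym (Vec.tabulate∘lookup u)) (trans (Vec.tabulate-cong eq) (Vec.tabulate∘lookup v))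

comprehension : {P : Fin m → Set} → Decidable P → Subset m
comprehension P? = Vec.tabulate (does ∘ P?)

∈-comprehension⁺ : {P : Fin m → Set} (P? : Decidable P) {v : Fin m} → P v → v ∈ comprehension P?
∈-comprehension⁺ P? {v} p =
  Vec.lookup⇒[]= v _ (trans (Vec.lookup∘tabulate (does ∘ P?) v) (dec-true (P? v) p))

∈-comprehension⁻ : {P : Fin m → Set} (P? : Decidable P) {v : Fin m} → v ∈ comprehension P? → P v
∈-comprehension⁻ P? {v} v∈
  with P? v | trans (sym (Vec.lookup∘tabulate (does ∘ P?) v)) (Vec.[]=⇒lookup v∈)
... | yes p | _ = p
... | no _  | ()

∈-⋃⁺ : {v : Fin m} {p : Subset m} {ps : List (Subset m)} → v ∈ p → p ∈ˡ ps → v ∈ ⋃ ps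
∈-⋃⁺ v∈p (here refl) = x∈p∪q⁺ (inj₁ v∈p)
∈-⋃⁺ v∈p (there p∈)  = x∈p∪q⁺ (inj₂ (∈-⋃⁺ v∈p p∈))

∈-⋃⁻ : {v : Fin m} (ps : List (Subset m)) → v ∈ ⋃ ps → ∃ λ p → p ∈ˡ ps × v ∈ p
∈-⋃⁻ []       v∈ = ⊥-elim (∉⊥ v∈)
∈-⋃⁻ (p ∷ ps) v∈ with x∈p∪q⁻ p (⋃ ps) v∈
... | inj₁ v∈p = p , here refl , v∈p
... | inj₂ v∈⋃ = let q , q∈ , v∈q = ∈-⋃⁻ ps v∈⋃ in q , there q∈ , v∈q

∈-⋂∁⁺ : {v : Fin m} {ps : List (Subset m)} → All (v ∉_) ps → v ∈ ⋂ (map ∁ ps)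
∈-⋂∁⁺ []          = ∈⊤
∈-⋂∁⁺ (v∉p ∷ v∉) = x∈p∩q⁺ (x∉p⇒x∈∁p v∉p , ∈-⋂∁⁺ v∉)

∈-⋂∁⁻ : {v : Fin m} (ps : List (Subset m)) → v ∈ ⋂ (map ∁ ps) → All (v ∉_) ps
∈-⋂∁⁻ []       _  = []
∈-⋂∁⁻ (p ∷ ps) v∈ = let v∈∁p , v∈⋂ = x∈p∩q⁻ (∁ p) (⋂ (map ∁ ps)) v∈ in
  x∈∁p⇒x∉p v∈∁p ∷ ∈-⋂∁⁻ ps v∈⋂

∈-prefix⁺ : {v : Fin m} {k : ℕ} (D : Vec (Subset m) l) {i : Fin l} → toℕ i < k →
            v ∈ lookup D i → v ∈ ⋃ (List.take k (toList D))
∈-prefix⁺ {k = suc k} (p ∷ D) {Fin.zero}  _         v∈ = x∈p∪q⁺ (inj₁ v∈)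
∈-prefix⁺ {k = suc k} (p ∷ D) {Fin.suc i} (s≤s i<k) v∈ = x∈p∪q⁺ (inj₂ (∈-prefix⁺ D i<k v∈))

∈-prefix⁻ : {v : Fin m} (k : ℕ) (D : Vec (Subset m) l) → v ∈ ⋃ (List.take k (toList D)) →
            ∃ λ i → toℕ i < k × v ∈ lookup D i
∈-prefix⁻ zero    D       v∈ = ⊥-elim (∉⊥ v∈)
∈-prefix⁻ (suc k) []      v∈ = ⊥-elim (∉⊥ v∈)
∈-prefix⁻ (suc k) (p ∷ D) v∈ with x∈p∪q⁻ p _ v∈
... | inj₁ v∈p = Fin.zero , s≤s z≤n , v∈p
... | inj₂ v∈⋃ = let i , i<k , v∈D = ∈-prefix⁻ k D v∈⋃ in Fin.suc i , s≤s i<k , v∈D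

-- Presents the union of all parts as a prefix union, so that the two prefix lemmas serve both
-- `IsDecomposition` and `factor`.
take-toList : (D : Vec A l) → List.take l (toList D) ≡ toList D
take-toList {l = l} D = List.take-all l (toList D) (ℕ.≤-reflexive (Vec.length-toList D))

module _ {I : Subset m} {D : Vec (Subset m) l} (dec : IsDecomposition I D) where

  part⊆ : ∀ i → lookup D i ⊆ I
  part⊆ i v∈ = subst (_ ∈_) (trans (cong ⋃ (take-toList D)) (proj₂ dec))
    (∈-prefix⁺ D (Fin.toℕ<n i) v∈)

  part-of : ∀ {v} → v ∈ I → ∃ λ i → v ∈ lookup D i
  part-of v∈I =
    let i , _ , v∈ = ∈-prefix⁻ l D (subst (_ ∈_) (sym (trans (cong ⋃ (take-toList D)) (proj₂ dec))) v∈I)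
    in i , v∈

  part-unique : ∀ {v i j} → v ∈ lookup D i → v ∈ lookup D j → i ≡ j
  part-unique = go (proj₁ dec)
    where
    go : ∀ {l} {D : Vec (Subset m) l} → VecAllPairs.AllPairs Disjoint D →
         ∀ {v i j} → v ∈ lookup D i → v ∈ lookup D j → i ≡ j
    go (d ∷ ds) {i = Fin.zero}  {Fin.zero}  _  _  = refl
    go (d ∷ ds) {i = Fin.zero}  {Fin.suc j} v∈ w∈ = contradiction (_ , x∈p∩q⁺ (v∈ , w∈)) (VecAll.lookup⁺ d j)
    go (d ∷ ds) {i = Fin.suc i} {Fin.zero}  v∈ w∈ = contradiction (_ , x∈p∩q⁺ (w∈ , v∈)) (VecAll.lookup⁺ d i)
    go (d ∷ ds) {i = Fin.suc i} {Fin.suc j} v∈ w∈ = cong Fin.suc (go ds v∈ w∈)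

-- Level sets of a coloring

level? : (S : Coloring m n) (I : Subset m) (k : Fin n) → Decidable (λ v → v ∈ I × lookup S v ≡ k)
level? S I k v = v ∈? I ×-dec lookup S v Fin.≟ k

-- `g` names the color of each part. It is `id` for decompositions, where levels may be empty, and
-- `lookup ks` for compositions of f(H), where only attained colors are listed.
levels : (Fin l → Fin n) → Coloring m n → Subset m → Vec (Subset m) l
levels g S I = Vec.tabulate (λ i → comprehension (level? S I (g i)))

∈-levels⁺ : (g : Fin l → Fin n) (S : Coloring m n) {I : Subset m} → ∀ {i v} →
            v ∈ I → lookup S v ≡ g i → v ∈ lookup (levels g S I) i
∈-levels⁺ g S {I} {i} v∈I Sv≡ = subst (_ ∈_) (sym (Vec.lookup∘tabulate _ i))
  (∈-comprehension⁺ (level? S I (g i)) (v∈I , Sv≡))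

∈-levels⁻ : (g : Fin l → Fin n) (S : Coloring m n) (I : Subset m) → ∀ {i v} →
            v ∈ lookup (levels g S I) i → v ∈ I × lookup S v ≡ g i
∈-levels⁻ g S I {i} v∈ =
  ∈-comprehension⁻ (level? S I (g i)) (subst (_ ∈_) (Vec.lookup∘tabulate _ i) v∈)

levels-isDecomposition : {g : Fin l → Fin n} → (∀ {i j} → g i ≡ g j → i ≡ j) →
  (S : Coloring m n) {I : Subset m} → (∀ {v} → v ∈ I → ∃ λ i → lookup S v ≡ g i) →
  IsDecomposition I (levels g S I)
levels-isDecomposition {l = l} {g = g} g-inj S {I} covers =
  VecAllPairs.tabulate⁺ (λ {i} {j} i≢j (v , v∈) →
    let v∈i , v∈j = x∈p∩q⁻ _ _ v∈ in
    i≢j (g-inj (trans (sym (proj₂ (∈-comprehension⁻ (level? S I (g i)) v∈i)))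
                      (proj₂ (∈-comprehension⁻ (level? S I (g j)) v∈j))))) ,
  ⊆-antisym
    (λ v∈⋃ → let i , _ , v∈ = ∈-prefix⁻ l (levels g S I)
                   (subst (λ ps → _ ∈ ⋃ ps) (sym (take-toList (levels g S I))) v∈⋃)
             in proj₁ (∈-levels⁻ g S I v∈))
    (λ v∈I → let i , Sv≡ = covers v∈I in
      subst (λ ps → _ ∈ ⋃ ps) (take-toList (levels g S I))
        (∈-prefix⁺ (levels g S I) (Fin.toℕ<n i) (∈-levels⁺ g S v∈I Sv≡)))

-- For `g = id` and a decomposition of all vertices this identifies `S` with `D`; for
-- `g = lookup ks` it prescribes `S` only on the union of the parts.
Colors : (Fin l → Fin n) → Vec (Subset m) l → Coloring m n → Set
Colors g D S = ∀ i v → v ∈ lookup D i → lookup S v ≡ g i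

colors? : (g : Fin l → Fin n) (D : Vec (Subset m) l) → Decidable (Colors g D)
colors? g D S = Fin.all? λ i → Fin.all? λ v → v ∈? lookup D i →-dec lookup S v Fin.≟ g i

-- A vertex of `I` with color `g i` lies in some part `j`, so `g j` equals `g i` and injectivity
-- gives `j ≡ i`. Hence `S` leaves only one choice for `D`.
levels-unique : {g : Fin l → Fin n} → (∀ {i j} → g i ≡ g j → i ≡ j) →
  (S : Coloring m n) {I : Subset m} {D : Vec (Subset m) l} →
  IsDecomposition I D → Colors g D S → D ≡ levels g S I
levels-unique {g = g} g-inj S {I} {D} dec col = lookup-ext λ i → ⊆-antisym
  (λ {v} v∈ → ∈-levels⁺ g S (part⊆ dec i v∈) (col i v v∈))
  (λ {v} v∈ → let v∈I , Sv≡ = ∈-levels⁻ g S I v∈ ; j , v∈j = part-of dec v∈I in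
    subst (λ i → v ∈ lookup D i) (g-inj (trans (sym (col j v v∈j)) Sv≡)) v∈j)

-- Subsets with at most one element, and maximal vertices

x∈p─q⇒x∉q : (p q : Subset m) {v : Fin m} → v ∈ p ─ q → v ∉ q
x∈p─q⇒x∉q (_ ∷ p) (outside ∷ q) (there v∈) (there v∈q) = x∈p─q⇒x∉q p q v∈ v∈q
x∈p─q⇒x∉q (_ ∷ p) (inside  ∷ q) (there v∈) (there v∈q) = x∈p─q⇒x∉q p q v∈ v∈q

x∈p-y⇒x≢y : (p : Subset m) {v w : Fin m} → v ∈ p - w → v ≢ w
x∈p-y⇒x≢y p {w = w} v∈ refl = x∈p─q⇒x∉q p ⁅ w ⁆ v∈ (x∈⁅x⁆ w)

-- If `v` and `w` differed, deleting `v` would lower the cardinality and still leave `w`.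
∣p∣≤1⁻ : {p : Subset m} → ∣ p ∣ ≤ 1 → ∀ {v w} → v ∈ p → w ∈ p → v ≡ w
∣p∣≤1⁻ {p = p} ∣p∣≤1 {v} {w} v∈ w∈ with v Fin.≟ w
... | yes v≡w = v≡w
... | no  v≢w = contradiction (ℕ.≤-trans (s≤s 1≤) (ℕ.≤-trans (x∈p⇒∣p-x∣<∣p∣ v∈) ∣p∣≤1)) λ { (s≤s ()) }
  where
  1≤ : 1 ≤ ∣ p - v ∣
  1≤ = ℕ.≤-trans (ℕ.≤-reflexive (sym (∣⁅x⁆∣≡1 w))) (p⊆q⇒∣p∣≤∣q∣ λ x∈ →
    subst (_∈ p - v) (sym (x∈⁅y⁆⇒x≡y w x∈)) (x∈p∧x≢y⇒x∈p-y w∈ (v≢w ∘ sym)))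

∣p∣≤1⁺ : {p : Subset m} → (∀ {v w} → v ∈ p → w ∈ p → v ≡ w) → ∣ p ∣ ≤ 1
∣p∣≤1⁺ {m} {p} uniq with nonempty? p
... | yes (v , v∈) = ℕ.≤-trans
  (p⊆q⇒∣p∣≤∣q∣ λ w∈ → subst (_∈ ⁅ v ⁆) (uniq v∈ w∈) (x∈⁅x⁆ v)) (ℕ.≤-reflexive (∣⁅x⁆∣≡1 v))
... | no empty = ℕ.≤-trans
  (p⊆q⇒∣p∣≤∣q∣ {q = ⊥} λ v∈ → contradiction (_ , v∈) empty) (ℕ.≤-trans (ℕ.≤-reflexive (∣⊥∣≡0 m)) z≤n)

∃-maximal : (S : Coloring m n) {p : Subset m} → Nonempty p → ∃ (Maximal S p)
∃-maximal {m} S {p} (v₀ , v₀∈) = v , argmax-all (lookup S) v₀∈ (All.all-filter (_∈? p) (allFin m)) ,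
  λ w w∈ → All.lookup (f[xs]≤f[argmax] {f = lookup S} v₀ xs) (∈-filter⁺ (_∈? p) (∈-allFin w) w∈)
  where
  open import Data.List.Extrema (Fin.≤-totalOrder _) using (argmax; argmax-all; f[xs]≤f[argmax])
  xs : List (Fin m)
  xs = filter (_∈? p) (allFin m)
  -- `argmax` may return its default `v₀`; this is why `argmax-all` is also given `v₀∈`.
  v : Fin m
  v = argmax (lookup S) v₀ xs

-- Discrete factors and unique maxima

module _ (H : Hypergraph {m} ⊤) where

  edge-of : {p : Subset m} → p ∈ˡ edges H → Nonempty p → ∃ λ e → vertices H e ≡ p
  edge-of p∈ ne = let p∈ne = ∈-filter⁺ nonempty? p∈ ne in Any.index p∈ne , sym (Any.lookup-index p∈ne)

  vertices∈edges : ∀ e → vertices H e ∈ˡ edges H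
  vertices∈edges e = proj₁ (∈-filter⁻ nonempty? (∈-lookup {xs = nonemptyEdges H} e))

  vertices-nonempty : ∀ e → Nonempty (vertices H e)
  vertices-nonempty e = proj₂ (∈-filter⁻ nonempty? {xs = edges H} (∈-lookup {xs = nonemptyEdges H} e))

  module _ {D : Vec (Subset m) n} (S : Coloring m n) (dec : IsDecomposition ⊤ D) (col : Colors id D S) where

    private
      -- As parts are counted from 0, these are the vertices of color less than `k`. The i-th factor
      -- therefore lives on the vertices of color exactly `i`, called its layer below.
      U : ℕ → Subset m
      U k = ⋃ (List.take k (toList D))

      ∈-U⁺ : ∀ {k v} → toℕ (lookup S v) < k → v ∈ U k
      ∈-U⁺ {k} {v} Sv<k = let i , v∈ = part-of dec ∈⊤ in
        ∈-prefix⁺ D (subst (λ i → toℕ i < k) (col i v v∈) Sv<k) v∈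

      ∈-U⁻ : ∀ {k v} → v ∈ U k → toℕ (lookup S v) < k
      ∈-U⁻ {k} {v} v∈U = let i , i<k , v∈ = ∈-prefix⁻ k D v∈U in
        subst (λ i → toℕ i < k) (sym (col i v v∈)) i<k

      layer⁺ : ∀ {i v} → lookup S v ≡ i → v ∈ U (suc (toℕ i)) ─ U (toℕ i)
      layer⁺ refl = x∈p∧x∉q⇒x∈p─q (∈-U⁺ ℕ.≤-refl) (ℕ.<-irrefl refl ∘ ∈-U⁻)

      layer⁻ : ∀ {i v} → v ∈ U (suc (toℕ i)) ─ U (toℕ i) → lookup S v ≡ i
      layer⁻ {i} {v} v∈ = Fin.toℕ-injective (ℕ.≤-antisym
        (ℕ.≤-pred (∈-U⁻ {suc (toℕ i)} (p─q⊆p _ _ v∈)))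
        (ℕ.≮⇒≥ (x∈p─q⇒x∉q _ _ v∈ ∘ ∈-U⁺ {toℕ i})))

    -- Let `i` be the largest color on the edge. The edge survives restriction to `U (suc i)` and is
    -- not contained in `U i`, so its trace on the layer is an edge of the i-th factor. All its
    -- maximal vertices lie in that trace.
    discrete⇒uniqueMaxima : (∀ i → Discrete (factor H D i)) → HasUniqueMaxima H S
    discrete⇒uniqueMaxima disc e = v , (v∈p , v-max) , unique
      where
      p : Subset m
      p = vertices H e
      max : ∃ (Maximal S p)
      max = ∃-maximal S (vertices-nonempty e)
      v : Fin m
      v = proj₁ max
      v∈p : v ∈ p
      v∈p = proj₁ (proj₂ max)
      v-max : ∀ w → w ∈ p → lookup S w Fin.≤ lookup S v
      v-max = proj₂ (proj₂ max)
      i : Fin n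
      i = lookup S v
      p⊆U : p ⊆ U (suc (toℕ i))
      p⊆U w∈ = ∈-U⁺ (s≤s (v-max _ w∈))
      p⊈U : ¬ (p ⊆ U (toℕ i))
      p⊈U p⊆ = ℕ.<-irrefl refl (∈-U⁻ (p⊆ v∈p))
      -- The leading `there` skips the `⊥` that `contract` puts first.
      small : ∣ p ∩ (U (suc (toℕ i)) ─ U (toℕ i)) ∣ ≤ 1
      small = All.lookup (disc i) (there (∈-map⁺ (_∩ (U (suc (toℕ i)) ─ U (toℕ i)))
        (∈-filter⁺ _ (∈-filter⁺ (_⊆? U (suc (toℕ i))) (vertices∈edges e) p⊆U) p⊈U)))
      unique : ∀ {w} → Maximal S p w → v ≡ w
      unique {w} (w∈p , w-max) = ∣p∣≤1⁻ small
        (x∈p∩q⁺ (v∈p , layer⁺ refl))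
        (x∈p∩q⁺ (w∈p , layer⁺ (Fin.≤-antisym (v-max w w∈p) (w-max v v∈p))))

    -- An edge of the i-th factor is `⊥` or the trace of some `p` whose colors are at most `i`.
    -- Vertices of the trace have color `i`, so they are maximal in `p` and therefore coincide.
    uniqueMaxima⇒discrete : HasUniqueMaxima H S → ∀ i → Discrete (factor H D i)
    uniqueMaxima⇒discrete um i = ℕ.≤-trans (ℕ.≤-reflexive (∣⊥∣≡0 m)) z≤n ∷
      All.map⁺ (All.tabulate small)
      where
      small : ∀ {p} → p ∈ˡ filter _ (filter (_⊆? U (suc (toℕ i))) (edges H)) →
              ∣ p ∩ (U (suc (toℕ i)) ─ U (toℕ i)) ∣ ≤ 1
      -- The vertex `v` itself shows that `p` is nonempty, which `edge-of` needs.
      small {p} p∈ = ∣p∣≤1⁺ λ {v} v∈ w∈ →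
        let e , e≡p = edge-of p∈edges (v , proj₁ (x∈p∩q⁻ p _ v∈))
            _ , _ , unique = um e
        in trans (sym (unique (subst (λ q → Maximal S q _) (sym e≡p) (top v∈))))
                 (unique (subst (λ q → Maximal S q _) (sym e≡p) (top w∈)))
        where
        p∈edges : p ∈ˡ edges H
        p∈edges = proj₁ (∈-filter⁻ (_⊆? U (suc (toℕ i))) (proj₁ (∈-filter⁻ _ p∈)))
        p⊆U : p ⊆ U (suc (toℕ i))
        p⊆U = proj₂ (∈-filter⁻ (_⊆? U (suc (toℕ i))) {xs = edges H} (proj₁ (∈-filter⁻ _ p∈)))
        top : ∀ {v} → v ∈ p ∩ (U (suc (toℕ i)) ─ U (toℕ i)) → Maximal S p v
        top v∈ = let v∈p , v∈layer = x∈p∩q⁻ p _ v∈ in v∈p , λ w w∈p →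
          ℕ.≤-trans (ℕ.≤-pred (∈-U⁻ (p⊆U w∈p))) (ℕ.≤-reflexive (cong toℕ (sym (layer⁻ v∈layer))))

∈-subsets : (p : Subset m) → p ∈ˡ subsets m
∈-subsets = ∈-vecs λ { true → here refl ; false → there (here refl) }

subsets-unique : Unique (subsets m)
subsets-unique {m} = vecs-unique (((λ ()) ∷ []) ∷ [] ∷ []) m

colorings-unique : Unique (colorings m n)
colorings-unique {m} {n} = vecs-unique (Unique.allFin⁺ n) m

∈-colorings : (S : Coloring m n) → S ∈ˡ colorings m n
∈-colorings = ∈-vecs ∈-allFin

-- Counts pairs of a decomposition and the coloring identified with it. Keeping `HasUniqueMaxima`
-- inside the relation makes the sum over `S` the indicator of discreteness, and the sum over `D`
-- that of unique maxima.
χ≡#uniqueMaxima : (H : Hypergraph {m} ⊤) (n : ℕ) →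
                  χ H n ≡ ∑ (colorings m n) (⟦_⟧ ∘ hasUniqueMaxima? H)
χ≡#uniqueMaxima {m} H n = begin
  ∑ Ds (λ D → product (map (λ i → ζ (factor H D i)) (allFin n)))
    ≡⟨ ∑-cong Ds (λ {D} _ → product-⟦⟧ (λ i → discrete? (factor H D i))) ⟩
  ∑ Ds (λ D → ⟦ Fin.all? (λ i → discrete? (factor H D i)) ⟧)
    ≡⟨ ∑-cong Ds (λ {D} D∈ → sym (∑-unique (R? D) (Fin.all? (λ i → discrete? (factor H D i))) colorings-unique
         (one-coloring D∈)
         (λ {S} _ (col , um) → uniqueMaxima⇒discrete H S (isDec D∈) col um)
         (λ _ _ (col , _) (col′ , _) → lookup-ext λ v →
           let i , v∈ = part-of (isDec D∈) ∈⊤ in trans (col i v v∈) (sym (col′ i v v∈))))) ⟩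
  ∑ Ds (λ D → ∑ Ss (λ S → ⟦ R? D S ⟧))
    ≡⟨ ∑-comm Ds Ss (λ D S → ⟦ R? D S ⟧) ⟩
  ∑ Ss (λ S → ∑ Ds (λ D → ⟦ R? D S ⟧))
    ≡⟨ ∑-cong Ss (λ {S} _ → ∑-unique (λ D → R? D S) (hasUniqueMaxima? H S)
         (Unique.filter⁺ (isDecomposition? ⊤) (vecs-unique subsets-unique n))
         (λ um → levels id S ⊤ ,
           ∈-filter⁺ (isDecomposition? ⊤) (∈-vecs ∈-subsets (levels id S ⊤))
             (levels-isDecomposition id S (λ {v} _ → lookup S v , refl)) ,
           (λ i v v∈ → proj₂ (∈-levels⁻ id S ⊤ v∈)) , um)
         (λ _ → proj₂)
         (λ D∈ D′∈ (col , _) (col′ , _) →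
           trans (levels-unique id S (isDec D∈) col) (sym (levels-unique id S (isDec D′∈) col′)))) ⟩
  ∑ Ss (⟦_⟧ ∘ hasUniqueMaxima? H) ∎
  where
  open ≡-Reasoning
  Ds = decompositions ⊤ n
  Ss = colorings m n
  R? : (D : Vec (Subset m) n) (S : Coloring m n) → Dec (Colors id D S × HasUniqueMaxima H S)
  R? D S = colors? id D S ×-dec hasUniqueMaxima? H S
  isDec : ∀ {D} → D ∈ˡ Ds → IsDecomposition ⊤ D
  isDec D∈ = proj₂ (∈-filter⁻ (isDecomposition? ⊤) {xs = vecs (subsets m) n} D∈)
  one-coloring : ∀ {D} → D ∈ˡ Ds → (∀ i → Discrete (factor H D i)) →
                 ∃ λ S → S ∈ˡ Ss × Colors id D S × HasUniqueMaxima H S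
  one-coloring {D} D∈ disc = S , ∈-colorings S , col , discrete⇒uniqueMaxima H S (isDec D∈) col disc
    where
    S = Vec.tabulate (λ v → proj₁ (part-of (isDec D∈) {v} ∈⊤))
    col : Colors id D S
    col i v v∈ = trans (Vec.lookup∘tabulate _ v)
      (part-unique (isDec D∈) (proj₂ (part-of (isDec D∈) ∈⊤)) v∈)

-- Orientations

-- If `v` had the same color as f(e), it would be a second maximal vertex of the edge.
compatible-< : (H : Hypergraph {m} ⊤) (f : Assignment H) (S : Coloring m n) →
  StrictlyCompatible H f S → ∀ e {v} → v ∈ vertices H e → v ≢ lookup f e →
  lookup S v Fin.< lookup S (lookup f e)
compatible-< H f S compat e {v} v∈ v≢ with compat e
... | (_ , max) , unique = Fin.≤∧≢⇒< (max v v∈) λ Sv≡ →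
  v≢ (sym (unique (v∈ , λ w w∈ → ℕ.≤-trans (max w w∈) (ℕ.≤-reflexive (cong toℕ (sym Sv≡))))))

-- Another maximal vertex would have a color both below that of f(e) and at least as large.
<-compatible : (H : Hypergraph {m} ⊤) (f : Assignment H) (S : Coloring m n) → IsOrientation H f →
  (∀ e {v} → v ∈ vertices H e → v ≢ lookup f e → lookup S v Fin.< lookup S (lookup f e)) →
  StrictlyCompatible H f S
<-compatible H f S orient below e = (orient e , max) , unique
  where
  max : ∀ w → w ∈ vertices H e → lookup S w Fin.≤ lookup S (lookup f e)
  max w w∈ with w Fin.≟ lookup f e
  ... | yes refl = ℕ.≤-refl
  ... | no  w≢   = ℕ.<⇒≤ (below e w∈ w≢)
  unique : ∀ {w} → Maximal S (vertices H e) w → lookup f e ≡ w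
  unique {w} (w∈ , w-max) with w Fin.≟ lookup f e
  ... | yes w≡ = sym w≡
  ... | no  w≢ = contradiction (ℕ.<-≤-trans (below e w∈ w≢) (w-max _ (orient e))) (ℕ.<-irrefl refl)

-- For an arc from `d` to `e`, f(d) lies in `e` and differs from f(e), so the color of the chosen
-- vertex rises. Around a cycle it would exceed itself.
compatible⇒acyclic : (H : Hypergraph {m} ⊤) (f : Assignment H) (S : Coloring m n) →
  StrictlyCompatible H f S → Acyclic H f
compatible⇒acyclic H f S compat (e , es , _ , linked) = ℕ.<-irrefl refl (ascend e es linked)
  where
  color : Edge H → ℕ
  color e = toℕ (lookup S (lookup f e))
  step : ∀ {d e} → Arc H f d e → color d < color e
  step {d} {e} arc = compatible-< H f S compat e (p─q⊆p (vertices H e) ⁅ lookup f e ⁆ arc)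
    (x∈p-y⇒x≢y (vertices H e) arc)
  ascend : ∀ d es {e} → Linked (Arc H f) (d ∷ es ∷ʳ e) → color d < color e
  ascend d []       (arc ∷ _)    = step arc
  ascend d (c ∷ es) (arc ∷ arcs) = ℕ.<-trans (step arc) (ascend c es arcs)

∈-acyclicOrientations⁻ : (H : Hypergraph {m} ⊤) {f : Assignment H} → f ∈ˡ acyclicOrientations H →
                         IsOrientation H f
∈-acyclicOrientations⁻ {m} H f∈ = proj₂ (∈-filter⁻ (isOrientation? H) {xs = vecs (allFin m) _}
  (proj₁ (∈-filter⁻ (acyclic? H) f∈)))

-- For fixed `S` a compatible orientation exists exactly when maxima are unique, and they determine
-- it. Acyclicity follows from compatibility, so summing over acyclic orientations alone loses
-- nothing.
#uniqueMaxima≡#compatible : (H : Hypergraph {m} ⊤) (n : ℕ) →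
  ∑ (colorings m n) (⟦_⟧ ∘ hasUniqueMaxima? H) ≡
  ∑ (acyclicOrientations H) (λ f → ∑ (colorings m n) (⟦_⟧ ∘ strictlyCompatible? H f))
#uniqueMaxima≡#compatible {m} H n = begin
  ∑ Ss (⟦_⟧ ∘ hasUniqueMaxima? H)
    ≡⟨ ∑-cong Ss (λ {S} _ → sym (∑-unique (λ f → strictlyCompatible? H f S) (hasUniqueMaxima? H S)
         (Unique.filter⁺ (acyclic? H) (Unique.filter⁺ (isOrientation? H) (vecs-unique (Unique.allFin⁺ m) _)))
         (orientation S)
         (λ {f} _ compat e → lookup f e , compat e)
         (λ _ _ compat compat′ → lookup-ext λ e → proj₂ (compat e) (proj₁ (compat′ e))))) ⟩
  ∑ Ss (λ S → ∑ As (λ f → ⟦ strictlyCompatible? H f S ⟧))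
    ≡⟨ ∑-comm Ss As (λ S f → ⟦ strictlyCompatible? H f S ⟧) ⟩
  ∑ As (λ f → ∑ Ss (⟦_⟧ ∘ strictlyCompatible? H f)) ∎
  where
  open ≡-Reasoning
  Ss = colorings m n
  As = acyclicOrientations H
  orientation : ∀ S → HasUniqueMaxima H S → ∃ λ f → f ∈ˡ As × StrictlyCompatible H f S
  orientation S um = f ,
    ∈-filter⁺ (acyclic? H) (∈-filter⁺ (isOrientation? H) (∈-vecs ∈-allFin f)
      (λ e → proj₁ (proj₁ (compat e)))) (compatible⇒acyclic H f S compat) ,
    compat
    where
    f : Assignment H
    f = Vec.tabulate (proj₁ ∘ um)
    compat : StrictlyCompatible H f S
    compat e = subst (UniqueMaximal S (vertices H e)) (sym (Vec.lookup∘tabulate _ e)) (proj₂ (um e))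

-- Compositions and increasing sequences

-- A vertex `v` of the first part is outside the others, so deleting it from the whole union still
-- leaves their union. The bound shows that `compositions` misses no length.
length≤∣⋃∣ : {P : Vec (Subset m) l} → VecAllPairs.AllPairs Disjoint P → VecAll.All Nonempty P →
             l ≤ ∣ ⋃ (toList P) ∣
length≤∣⋃∣ [] _ = z≤n
length≤∣⋃∣ {l = suc l} {P = p ∷ P} (d ∷ ds) ((v , v∈p) VecAll.∷ ne) = begin
  suc l                          ≤⟨ s≤s (length≤∣⋃∣ ds ne) ⟩
  suc ∣ ⋃ (toList P) ∣           ≤⟨ s≤s (p⊆q⇒∣p∣≤∣q∣ ⋃P⊆) ⟩
  suc ∣ (p ∪ ⋃ (toList P)) - v ∣ ≤⟨ x∈p⇒∣p-x∣<∣p∣ (x∈p∪q⁺ {q = ⋃ (toList P)} (inj₁ v∈p)) ⟩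
  ∣ p ∪ ⋃ (toList P) ∣           ∎
  where
  open ℕ.≤-Reasoning
  w≢v : ∀ {w} → w ∈ ⋃ (toList P) → w ≢ v
  w≢v w∈ refl =
    let i , _ , v∈ = ∈-prefix⁻ l P (subst (λ ps → _ ∈ ⋃ ps) (sym (take-toList P)) w∈)
    in VecAll.lookup⁺ d i (_ , x∈p∩q⁺ (v∈p , v∈))
  ⋃P⊆ : ⋃ (toList P) ⊆ (p ∪ ⋃ (toList P)) - v
  ⋃P⊆ w∈ = x∈p∧x≢y⇒x∈p-y (x∈p∪q⁺ {p = p} (inj₂ w∈)) (w≢v w∈)

∈-compositions⁺ : {I : Subset m} (P : Vec (Subset m) l) → IsComposition I P → (l , P) ∈ˡ compositions I
∈-compositions⁺ {l = l} {I} P comp@((disjoint , ⋃≡I) , ne) = ∈-concatMap⁺ _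
  (Any.map (λ { refl → ∈-map⁺ (l ,_) (∈-filter⁺ (isComposition? I) (∈-vecs ∈-subsets P) comp) })
    (∈-upTo⁺ (s≤s (subst (λ J → l ≤ ∣ J ∣) ⋃≡I (length≤∣⋃∣ disjoint ne)))))

∈-compositions⁻ : {I : Subset m} {P : Vec (Subset m) l} → (l , P) ∈ˡ compositions I → IsComposition I P
∈-compositions⁻ {I = I} lP∈
  with k , lP∈k ← Any.satisfied (∈-concatMap⁻ _ {xs = List.upTo (suc ∣ I ∣)} lP∈)
  with _ , P∈ , refl ← ∈-map⁻ (k ,_) lP∈k
  = proj₂ (∈-filter⁻ (isComposition? I) {xs = vecs (subsets _) k} P∈)

compositions-unique : (I : Subset m) → Unique (compositions I)
compositions-unique I = concatMap-unique (Unique.upTo⁺ (suc ∣ I ∣))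
  (λ l → Unique.map⁺ (λ { refl → refl })
    (Unique.filter⁺ (isComposition? I) (vecs-unique subsets-unique l)))
  (λ z∈ z∈′ → let _ , _ , eq = ∈-map⁻ (_ ,_) z∈ ; _ , _ , eq′ = ∈-map⁻ (_ ,_) z∈′ in
    trans (sym (cong proj₁ eq)) (cong proj₁ eq′))

Increasing : Vec (Fin n) l → Set
Increasing = VecLinked.Linked Fin._<_

increasing-< : {ks : Vec (Fin n) l} → Increasing ks → ∀ {i j} → i Fin.< j → lookup ks i Fin.< lookup ks j
increasing-< inc = VecLinked.lookup⁺ ℕ.<-trans inc

increasing-≤ : {ks : Vec (Fin n) l} → Increasing ks → ∀ {i j} → i Fin.≤ j → lookup ks i Fin.≤ lookup ks j
increasing-≤ {ks = ks} inc {i} {j} i≤j with i Fin.≟ j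
... | yes refl = ℕ.≤-refl
... | no  i≢j  = ℕ.<⇒≤ (increasing-< inc (Fin.≤∧≢⇒< i≤j i≢j))

increasing-reflects-< : {ks : Vec (Fin n) l} → Increasing ks → ∀ {i j} →
                        lookup ks i Fin.< lookup ks j → i Fin.< j
increasing-reflects-< inc kᵢ<kⱼ = ℕ.≰⇒> λ j≤i → ℕ.<⇒≱ kᵢ<kⱼ (increasing-≤ inc j≤i)

increasing-injective : {ks : Vec (Fin n) l} → Increasing ks → ∀ {i j} → lookup ks i ≡ lookup ks j → i ≡ j
increasing-injective inc kᵢ≡kⱼ = Fin.≤-antisym
  (ℕ.≮⇒≥ λ j<i → ℕ.<-irrefl (cong toℕ (sym kᵢ≡kⱼ)) (increasing-< inc j<i))
  (ℕ.≮⇒≥ λ i<j → ℕ.<-irrefl (cong toℕ kᵢ≡kⱼ) (increasing-< inc i<j))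

private
  increasing-head : ∀ {k c} {ks : Vec (Fin n) l} → Increasing (k ∷ ks) →
                    ∃ (λ i → lookup (k ∷ ks) i ≡ c) → k Fin.≤ c
  increasing-head inc (i , refl) = increasing-≤ inc {Fin.zero} {i} z≤n

  -- A later entry exceeds the common head `k`, so its match cannot be the head.
  attained-tail : ∀ {l l′ k} {ks : Vec (Fin n) l} {ks′ : Vec (Fin n) l′} → Increasing (k ∷ ks) →
    (∀ i → ∃ λ j → lookup (k ∷ ks′) j ≡ lookup (k ∷ ks) i) → ∀ i → ∃ λ j → lookup ks′ j ≡ lookup ks i
  attained-tail inc f i with f (Fin.suc i)
  ... | Fin.suc j , eq = j , eq
  ... | Fin.zero  , eq = contradiction (increasing-< inc {Fin.zero} {Fin.suc i} (s≤s z≤n))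
                                       (ℕ.<-irrefl (cong toℕ eq))

-- Both heads are the least attained value, hence equal; the tails then attain the same values.
-- Pairing with the length is needed because the lengths are not known to agree beforehand.
increasing-unique : ∀ {l l′} {ks : Vec (Fin n) l} {ks′ : Vec (Fin n) l′} → Increasing ks → Increasing ks′ →
  (∀ i → ∃ λ j → lookup ks′ j ≡ lookup ks i) → (∀ j → ∃ λ i → lookup ks i ≡ lookup ks′ j) →
  (l , ks) ≡ (l′ , ks′)
increasing-unique {ks = []}     {[]}     _ _ _ _ = refl
increasing-unique {ks = []}     {_ ∷ _}  _ _ _ g with () ← proj₁ (g Fin.zero)
increasing-unique {ks = _ ∷ _}  {[]}     _ _ f _ with () ← proj₁ (f Fin.zero)
increasing-unique {ks = k ∷ ks} {k′ ∷ ks′} inc inc′ f g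
  with refl ← Fin.≤-antisym (increasing-head inc (g Fin.zero)) (increasing-head inc′ (f Fin.zero))
  with refl ← increasing-unique (VecLinked.tail inc) (VecLinked.tail inc′)
                (attained-tail inc f) (attained-tail inc′ g)
  = refl

fromList-increasing : {xs : List (Fin n)} → Linked Fin._<_ xs → Increasing (Vec.fromList xs)
fromList-increasing []         = VecLinked.[]
fromList-increasing [-]        = VecLinked.[-]
fromList-increasing (lt ∷ inc) = lt VecLinked.∷ fromList-increasing inc

-- Filtering `allFin` keeps its order, so the colors used on `I` come out strictly increasing.
values : Coloring m n → Subset m → List (Fin n)
values S I = filter (λ k → Fin.any? (level? S I k)) (allFin _)

values-increasing : (S : Coloring m n) (I : Subset m) → Increasing (Vec.fromList (values S I))
values-increasing S I = fromList-increasing (Linked.AllPairs⇒Linked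
  (AllPairs.filter⁺ (λ k → Fin.any? (level? S I k)) (AllPairs.tabulate⁺-< id)))

values-attained : (S : Coloring m n) (I : Subset m) → ∀ i →
                  ∃ λ v → v ∈ I × lookup S v ≡ lookup (Vec.fromList (values S I)) i
values-attained S I i = proj₂ (∈-filter⁻ (λ k → Fin.any? (level? S I k)) {xs = allFin _}
  (Vec.∈-fromList⁻ (Vec.∈-lookup i (Vec.fromList (values S I)))))

values-complete : (S : Coloring m n) {I : Subset m} → ∀ {v} → v ∈ I →
                  ∃ λ i → lookup S v ≡ lookup (Vec.fromList (values S I)) i
values-complete S {I} {v} v∈I = VecAny.index k∈ , VecAny.lookup-index k∈
  where
  k∈ : lookup S v Vec.∈ Vec.fromList (values S I)
  k∈ = Vec.∈-fromList⁺ (∈-filter⁺ (λ k → Fin.any? (level? S I k)) (∈-allFin _) (v , v∈I , refl))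

-- The colorings compatible with an orientation

module _ (H : Hypergraph {m} ⊤) (f : Assignment H) where

  Touches : Fin m → Subset m → Set
  Touches v p = ∃ λ e → lookup f e ∈ p × v ∈ vertices H e

  private
    -- Written as the first operand of the intersection in `tildes`, with which it agrees by
    -- definition.
    touched : Subset m → Subset m
    touched p = ⋃ (map (vertices H) (filter (λ e → lookup f e ∈? p) (allFin _)))

    ∈-touched⁺ : ∀ {p v} → Touches v p → v ∈ touched p
    ∈-touched⁺ {p} (e , fe∈p , v∈e) =
      ∈-⋃⁺ v∈e (∈-map⁺ (vertices H) (∈-filter⁺ (λ e → lookup f e ∈? p) (∈-allFin e) fe∈p))

    ∈-touched⁻ : ∀ {p v} → v ∈ touched p → Touches v p
    ∈-touched⁻ {p} v∈ with _ , q∈ , v∈q ← ∈-⋃⁻ _ v∈ with e , e∈ , refl ← ∈-map⁻ (vertices H) q∈ =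
      e , proj₂ (∈-filter⁻ (λ e → lookup f e ∈? p) {xs = allFin _} e∈) , v∈q

  ∈-image⁺ : ∀ e → lookup f e ∈ image H f
  ∈-image⁺ e = ∈-⋃⁺ (x∈⁅x⁆ _) (∈-map⁺ ⁅_⁆ (Vec.∈-toList⁺ (Vec.∈-lookup e f)))

  ∈-image⁻ : ∀ {v} → v ∈ image H f → ∃ λ e → lookup f e ≡ v
  ∈-image⁻ v∈ with _ , p∈ , v∈p ← ∈-⋃⁻ _ v∈ with w , w∈ , refl ← ∈-map⁻ ⁅_⁆ p∈ =
    VecAny.index w∈f , trans (sym (VecAny.lookup-index w∈f)) (sym (x∈⁅y⁆⇒x≡y w v∈p))
    where
    w∈f : w Vec.∈ f
    w∈f = Vec.∈-toList⁻ w∈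

  -- `earlier` stays arbitrary here and in the next two lemmas because the recursion extends it.
  tildes-sound : ∀ earlier (P : Vec (Subset m) l) i {v} → v ∈ lookup (tildes H f earlier P) i →
                 Touches v (lookup P i) × v ∉ image H f × All (v ∉_) earlier
  tildes-sound earlier (p ∷ P) Fin.zero v∈ =
    let v∈touched , v∈rest = x∈p∩q⁻ (touched p) _ v∈
        v∈∁image , v∈⋂ = x∈p∩q⁻ (∁ (image H f)) _ v∈rest
    in ∈-touched⁻ v∈touched , x∈∁p⇒x∉p v∈∁image , ∈-⋂∁⁻ earlier v∈⋂
  tildes-sound earlier (p ∷ P) (Fin.suc i) v∈ =
    let touches , v∉image , v∉ = tildes-sound _ P i v∈ in touches , v∉image , All.tail v∉

  -- Each later set avoids `earlier`, which by then contains every set formed before it.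
  tildes-unique : ∀ earlier (P : Vec (Subset m) l) {i j v} →
    v ∈ lookup (tildes H f earlier P) i → v ∈ lookup (tildes H f earlier P) j → i ≡ j
  tildes-unique earlier (p ∷ P) {Fin.zero}  {Fin.zero}  _  _   = refl
  tildes-unique earlier (p ∷ P) {Fin.zero}  {Fin.suc j} v∈ v∈′ =
    contradiction v∈ (All.head (proj₂ (proj₂ (tildes-sound _ P j v∈′))))
  tildes-unique earlier (p ∷ P) {Fin.suc i} {Fin.zero}  v∈ v∈′ =
    contradiction v∈′ (All.head (proj₂ (proj₂ (tildes-sound _ P i v∈))))
  tildes-unique earlier (p ∷ P) {Fin.suc i} {Fin.suc j} v∈ v∈′ =
    cong Fin.suc (tildes-unique _ P v∈ v∈′)

  -- Going up the levels, `v` is either captured before level `i` or still free there and captured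
  -- at `i`. The bound on `j` makes the constraint at level `j` imply the one at level `i`.
  tildes-cover : ∀ earlier (P : Vec (Subset m) l) i {v} → Touches v (lookup P i) → v ∉ image H f →
    All (v ∉_) earlier → ∃ λ j → j Fin.≤ i × v ∈ lookup (tildes H f earlier P) j
  tildes-cover earlier (p ∷ P) Fin.zero touches v∉image v∉ = Fin.zero , z≤n ,
    x∈p∩q⁺ (∈-touched⁺ touches , x∈p∩q⁺ (x∉p⇒x∈∁p v∉image , ∈-⋂∁⁺ v∉))
  tildes-cover earlier (p ∷ P) (Fin.suc i) {v} touches v∉image v∉
    with v ∈? Vec.head (tildes H f earlier (p ∷ P))
  ... | yes v∈p̃ = Fin.zero , z≤n , v∈p̃
  ... | no  v∉p̃ = let j , j≤i , v∈ = tildes-cover _ P i touches v∉image (v∉p̃ ∷ v∉) in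
    Fin.suc j , s≤s j≤i , v∈

  -- Compatibility split into conditions that each involve the color of a single vertex, as `∑-vecs`
  -- requires.
  Fits : Vec (Subset m) l → Vec (Fin n) l → Fin m → Fin n → Set
  Fits P ks v c = (∀ i → v ∈ lookup P i → c ≡ lookup ks i) ×
                  (∀ i → v ∈ lookup (tildes H f [] P) i → c Fin.< lookup ks i)

  fits? : (P : Vec (Subset m) l) (ks : Vec (Fin n) l) → ∀ v → Decidable (Fits P ks v)
  fits? P ks v c =
    Fin.all? (λ i → v ∈? lookup P i →-dec c Fin.≟ lookup ks i) ×-dec
    Fin.all? (λ i → v ∈? lookup (tildes H f [] P) i →-dec c Fin.<? lookup ks i)

  module _ (orient : IsOrientation H f) (P : Vec (Subset m) l) (ks : Vec (Fin n) l)
           (comp : IsComposition (image H f) P) where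

    private
      P̃ : Fin l → Subset m
      P̃ = lookup (tildes H f [] P)

      k : Fin l → ℕ
      k i = toℕ (lookup ks i)

      image⇒∉P̃ : ∀ {v} → v ∈ image H f → ∀ i → v ∉ P̃ i
      image⇒∉P̃ v∈ i v∈P̃ = proj₁ (proj₂ (tildes-sound [] P i v∈P̃)) v∈

      touched⇒¬isolated : ∀ {e v} → v ∈ vertices H e → v ∉ isolated H
      touched⇒¬isolated {e} v∈e v∈J = x∈∁p⇒x∉p v∈J (∈-⋃⁺ v∈e (vertices∈edges H e))

      image⇒¬isolated : ∀ {v} → v ∈ image H f → v ∉ isolated H
      image⇒¬isolated v∈ with e , refl ← ∈-image⁻ v∈ = touched⇒¬isolated {e} (orient e)

      ∏-P̃-one : ∀ {v} → (∀ i → v ∉ P̃ i) → ∏ (λ i → k i ^ ⟦ v ∈? P̃ i ⟧) ≡ 1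
      ∏-P̃-one {v} v∉ = ∏-one λ i → ^-⟦⟧-no (k i) (v ∈? P̃ i) (v∉ i)

    -- An isolated vertex has `n` choices and a vertex of f(H) has one. Any other vertex lies in
    -- exactly one P̃ⱼ and has kⱼ choices. In each case the remaining factors on the right are 1.
    #fits : ∀ v → ∑ (allFin n) (λ c → ⟦ fits? P ks v c ⟧) ≡
                  n ^ ⟦ v ∈? isolated H ⟧ * ∏ (λ i → k i ^ ⟦ v ∈? P̃ i ⟧)
    #fits v with v ∈? isolated H
    ... | yes v∈J = begin
      ∑ (allFin n) (λ c → ⟦ fits? P ks v c ⟧)
        ≡⟨ ∑-allFin-one (λ c → ⟦⟧-yes (fits? P ks v c)
             ( (λ i v∈P → contradiction v∈J (image⇒¬isolated (part⊆ (proj₁ comp) i v∈P)))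
             , (λ i v∈P̃ → contradiction v∈P̃ (v∉P̃ i)))) ⟩
      n
        ≡⟨ trans (ℕ.*-identityʳ (n * 1)) (ℕ.*-identityʳ n) ⟨
      n ^ 1 * 1
        ≡⟨ cong (n ^ 1 *_) (∏-P̃-one v∉P̃) ⟨
      n ^ 1 * ∏ (λ i → k i ^ ⟦ v ∈? P̃ i ⟧) ∎
      where
      open ≡-Reasoning
      v∉P̃ : ∀ i → v ∉ P̃ i
      v∉P̃ i v∈P̃ = let (e , _ , v∈e) , _ = tildes-sound [] P i v∈P̃ in touched⇒¬isolated {e} v∈e v∈J
    ... | no v∉J with v ∈? image H f
    ... | yes v∈im = begin
      ∑ (allFin n) (λ c → ⟦ fits? P ks v c ⟧)
        -- The indicator of `yes v∈im` is 1, so this counts the single color forced by the part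
        -- containing `v`.
        ≡⟨ ∑-unique (fits? P ks v) (yes v∈im) (Unique.allFin⁺ n)
             (λ _ → lookup ks i , ∈-allFin _ ,
               (λ j v∈j → cong (lookup ks) (part-unique (proj₁ comp) v∈i v∈j)) ,
               (λ j v∈P̃ → contradiction v∈P̃ (image⇒∉P̃ v∈im j)))
             (λ _ _ → v∈im)
             (λ _ _ (on , _) (on′ , _) → trans (on i v∈i) (sym (on′ i v∈i))) ⟩
      1
        ≡⟨ trans (ℕ.*-identityˡ _) (∏-P̃-one (image⇒∉P̃ v∈im)) ⟨
      1 * ∏ (λ i → k i ^ ⟦ v ∈? P̃ i ⟧) ∎
      where
      open ≡-Reasoning
      i = proj₁ (part-of (proj₁ comp) v∈im)
      v∈i = proj₂ (part-of (proj₁ comp) v∈im)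
    ... | no v∉im = begin
      ∑ (allFin n) (λ c → ⟦ fits? P ks v c ⟧)
        ≡⟨ ∑-cong (allFin n) (λ {c} _ → ⟦⟧-cong (fits? P ks v c) (c Fin.<? lookup ks j) (mk⇔
             (λ (_ , below) → below j v∈P̃)
             (λ c<k → (λ i v∈P → contradiction (part⊆ (proj₁ comp) i v∈P) v∉im) ,
                      (λ i v∈P̃ᵢ → subst (λ i → c Fin.< lookup ks i) (tildes-unique [] P v∈P̃ v∈P̃ᵢ) c<k)))) ⟩
      ∑ (allFin n) (λ c → ⟦ c Fin.<? lookup ks j ⟧)
        ≡⟨ #< (lookup ks j) ⟩
      k j
        ≡⟨ ^-⟦⟧-yes (k j) (v ∈? P̃ j) v∈P̃ ⟨
      k j ^ ⟦ v ∈? P̃ j ⟧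
        ≡⟨ ∏-single j (λ i i≢j → ^-⟦⟧-no (k i) (v ∈? P̃ i) λ v∈P̃ᵢ → i≢j (tildes-unique [] P v∈P̃ᵢ v∈P̃)) ⟨
      ∏ (λ i → k i ^ ⟦ v ∈? P̃ i ⟧)
        ≡⟨ ℕ.*-identityˡ _ ⟨
      1 * ∏ (λ i → k i ^ ⟦ v ∈? P̃ i ⟧) ∎
      where
      open ≡-Reasoning
      -- As `v` is not isolated, it lies in a nonempty edge `e`; it is touched by the part
      -- containing f(e).
      covered : ∃ λ j → v ∈ P̃ j
      covered =
        let p , p∈ , v∈p = ∈-⋃⁻ (edges H) (x∉∁p⇒x∈p v∉J)
            e , e≡p = edge-of H p∈ (v , v∈p)
            i , fe∈i = part-of (proj₁ comp) (∈-image⁺ e)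
            j , _ , v∈P̃ = tildes-cover [] P i (e , fe∈i , subst (v ∈_) (sym e≡p) v∈p) v∉im []
        in j , v∈P̃
      j = proj₁ covered
      v∈P̃ = proj₂ covered

    -- Each exponent is the size of a set of vertices, so every power is a product over vertices.
    -- Exchanging the two products collects at `v` its number of admissible colors.
    #fitting : n ^ ∣ isolated H ∣ * product (toList (Vec.zipWith _^_ (Vec.map toℕ ks) (exponents H f P))) ≡
               ∑ (colorings m n) (λ S → ⟦ Fin.all? (λ v → fits? P ks v (lookup S v)) ⟧)
    #fitting = begin
      n ^ ∣ isolated H ∣ * product (toList (Vec.zipWith _^_ (Vec.map toℕ ks) (exponents H f P)))
        ≡⟨ cong₂ _*_ (sym (∏-^-∈ n (isolated H))) (trans
             (product-toList (Vec.zipWith _^_ (Vec.map toℕ ks) (exponents H f P))) (∏-cong λ i →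
             trans (Vec.lookup-zipWith _^_ i (Vec.map toℕ ks) (exponents H f P))
             (trans (cong₂ _^_ (Vec.lookup-map i toℕ ks) (Vec.lookup-map i ∣_∣ (tildes H f [] P)))
                    (sym (∏-^-∈ (k i) (P̃ i)))))) ⟩
      ∏ (λ v → n ^ ⟦ v ∈? isolated H ⟧) * ∏ (λ i → ∏ (λ v → k i ^ ⟦ v ∈? P̃ i ⟧))
        ≡⟨ cong (∏ (λ v → n ^ ⟦ v ∈? isolated H ⟧) *_) (∏-comm (λ i v → k i ^ ⟦ v ∈? P̃ i ⟧)) ⟩
      ∏ (λ v → n ^ ⟦ v ∈? isolated H ⟧) * ∏ (λ v → ∏ (λ i → k i ^ ⟦ v ∈? P̃ i ⟧))
        ≡⟨ ∏-distrib-* (λ v → n ^ ⟦ v ∈? isolated H ⟧) _ ⟨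
      ∏ (λ v → n ^ ⟦ v ∈? isolated H ⟧ * ∏ (λ i → k i ^ ⟦ v ∈? P̃ i ⟧))
        ≡⟨ ∏-cong #fits ⟨
      ∏ (λ v → ∑ (allFin n) (λ c → ⟦ fits? P ks v c ⟧))
        ≡⟨ ∑-vecs (allFin n) (fits? P ks) ⟨
      ∑ (colorings m n) (λ S → ⟦ Fin.all? (λ v → fits? P ks v (lookup S v)) ⟧) ∎
      where open ≡-Reasoning

  -- Take `v` in `e` other than f(e), with f(e) in part `j`. If `v` is in f(H), `Respects` puts it
  -- in a lower part, hence at a smaller color. Otherwise it lies in P̃ᵢ with i at most j, and its
  -- color is below kᵢ, which is at most kⱼ.
  fits⇒compatible : IsOrientation H f → {P : Vec (Subset m) l} {ks : Vec (Fin n) l} (S : Coloring m n) →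
    IsComposition (image H f) P → Respects H f P → Increasing ks →
    (∀ v → Fits P ks v (lookup S v)) → StrictlyCompatible H f S
  fits⇒compatible orient {P} {ks} S (dec , _) respects inc fits = <-compatible H f S orient below
    where
    below : ∀ e {v} → v ∈ vertices H e → v ≢ lookup f e → lookup S v Fin.< lookup S (lookup f e)
    below e {v} v∈e v≢ with part-of dec (∈-image⁺ e) | v ∈? image H f
    ... | j , fe∈j | yes v∈im = let i , v∈i = part-of dec v∈im in
      subst₂ Fin._<_ (sym (proj₁ (fits v) i v∈i)) (sym (proj₁ (fits (lookup f e)) j fe∈j))
        (increasing-< inc (respects e v (x∈p∩q⁺ (x∈p∧x≢y⇒x∈p-y v∈e v≢ , v∈im)) i j v∈i fe∈j))
    ... | j , fe∈j | no v∉im =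
      let i , i≤j , v∈P̃ = tildes-cover [] P j (e , fe∈j , v∈e) v∉im [] in
      subst (lookup S v Fin.<_) (sym (proj₁ (fits (lookup f e)) j fe∈j))
        (ℕ.<-≤-trans (proj₂ (fits v) i v∈P̃) (increasing-≤ inc i≤j))

  -- Index of the double sum over `P` and k₁ < ⋯ < kₗ, bundled with the length so that all lengths
  -- share one list.
  Cell : ℕ → Set
  Cell n = ∃ λ l → Vec (Subset m) l × Vec (Fin n) l

  Realizes : Coloring m n → Cell n → Set
  Realizes S (_ , P , ks) = ∀ v → Fits P ks v (lookup S v)

  realizes? : (S : Coloring m n) → Decidable (Realizes S)
  realizes? S (_ , P , ks) = Fin.all? (λ v → fits? P ks v (lookup S v))

  private
    sequences : (n l : ℕ) → List (Vec (Fin n) l)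
    sequences n l = filter (VecLinked.linked? Fin._<?_) (vecs (allFin n) l)

  cells : (n : ℕ) → List (Cell n)
  cells n = concatMap (λ (l , P) → map (λ ks → l , P , ks) (sequences n l)) (compatibleCompositions H f)

  cells-unique : ∀ n → Unique (cells n)
  cells-unique n = concatMap-unique
    (Unique.filter⁺ (λ (_ , P) → respects? H f P) (compositions-unique (image H f)))
    (λ (l , P) → Unique.map⁺ (λ { refl → refl })
      (Unique.filter⁺ (VecLinked.linked? Fin._<?_) (vecs-unique (Unique.allFin⁺ n) l)))
    (λ z∈ z∈′ → let _ , _ , eq = ∈-map⁻ _ z∈ ; _ , _ , eq′ = ∈-map⁻ _ z∈′ in
      trans (sym (cong forget eq)) (cong forget eq′))
    where
    forget : Cell n → ∃ (Vec (Subset m))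
    forget (l , P , _) = l , P

  ∈-cells⁺ : {P : Vec (Subset m) l} {ks : Vec (Fin n) l} →
    IsComposition (image H f) P → Respects H f P → Increasing ks → (l , P , ks) ∈ˡ cells n
  ∈-cells⁺ {l = l} {P = P} {ks} comp respects inc = ∈-concatMap⁺ _
    (Any.map (λ { refl → ∈-map⁺ (λ ks → l , P , ks)
                           (∈-filter⁺ (VecLinked.linked? Fin._<?_) (∈-vecs ∈-allFin ks) inc) })
      (∈-filter⁺ (λ (_ , P) → respects? H f P) (∈-compositions⁺ P comp) respects))

  ∈-compatibleCompositions⁻ : {P : Vec (Subset m) l} → (l , P) ∈ˡ compatibleCompositions H f →
    IsComposition (image H f) P × Respects H f P
  ∈-compatibleCompositions⁻ P∈ =
    let P∈comps , respects = ∈-filter⁻ (λ (_ , P) → respects? H f P) {xs = compositions (image H f)} P∈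
    in ∈-compositions⁻ P∈comps , respects

  ∈-cells⁻ : {P : Vec (Subset m) l} {ks : Vec (Fin n) l} → (l , P , ks) ∈ˡ cells n →
    IsComposition (image H f) P × Respects H f P × Increasing ks
  ∈-cells⁻ {n = n} c∈
    with (k , Q) , Q∈ , c∈Q ← find (∈-concatMap⁻ _ {xs = compatibleCompositions H f} c∈)
    with _ , ks∈ , refl ← ∈-map⁻ (λ ks → k , Q , ks) c∈Q
    = let comp , respects = ∈-compatibleCompositions⁻ Q∈ in
      comp , respects , proj₂ (∈-filter⁻ (VecLinked.linked? Fin._<?_) {xs = vecs (allFin n) k} ks∈)

  -- Parts are nonempty, so each entry of either sequence is a color attained on f(H), and both
  -- sequences list exactly these colors. Once the sequences agree, both compositions are the level
  -- sets of `S`.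
  cell-unique : (S : Coloring m n) {c c′ : Cell n} → c ∈ˡ cells n → c′ ∈ˡ cells n →
    Realizes S c → Realizes S c′ → c ≡ c′
  cell-unique S {l , P , ks} {l′ , P′ , ks′} c∈ c′∈ fits fits′
    with (dec , ne) , _ , inc ← ∈-cells⁻ c∈ | (dec′ , ne′) , _ , inc′ ← ∈-cells⁻ c′∈
    with refl ← increasing-unique inc inc′
      (λ i → let v , v∈i = VecAll.lookup⁺ ne i ; j , v∈j = part-of dec′ (part⊆ dec i v∈i) in
        j , trans (sym (proj₁ (fits′ v) j v∈j)) (proj₁ (fits v) i v∈i))
      (λ j → let v , v∈j = VecAll.lookup⁺ ne′ j ; i , v∈i = part-of dec (part⊆ dec′ j v∈j) in
        i , trans (sym (proj₁ (fits v) i v∈i)) (proj₁ (fits′ v) j v∈j))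
    = cong (λ P → l , P , ks) (trans
        (levels-unique (increasing-injective inc) S dec (λ i v → proj₁ (fits v) i))
        (sym (levels-unique (increasing-injective inc) S dec′ (λ i v → proj₁ (fits′ v) i))))

  -- The cell consists of the colors that `S` takes on f(H) and their level sets there.
  compatible⇒cell : (S : Coloring m n) → StrictlyCompatible H f S →
    ∃ λ c → c ∈ˡ cells n × Realizes S c
  compatible⇒cell {n = n} S compat = (_ , P , ks) , ∈-cells⁺ (dec , nonempty) respects inc , fits
    where
    I = image H f
    ks = Vec.fromList (values S I)
    inc : Increasing ks
    inc = values-increasing S I
    P = levels (lookup ks) S I
    dec : IsDecomposition I P
    dec = levels-isDecomposition (increasing-injective inc) S (values-complete S)
    color : ∀ {i v} → v ∈ lookup P i → lookup S v ≡ lookup ks i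
    color v∈ = proj₂ (∈-levels⁻ (lookup ks) S I v∈)
    nonempty : VecAll.All Nonempty P
    nonempty = VecAll.lookup⁻ λ i → let v , v∈I , Sv≡ = values-attained S I i in
      v , ∈-levels⁺ (lookup ks) S v∈I Sv≡
    respects : Respects H f P
    respects e v v∈ i j v∈i fe∈j = let v∈e-fe , _ = x∈p∩q⁻ (vertices H e - lookup f e) I v∈ in
      increasing-reflects-< inc (subst₂ Fin._<_ (color v∈i) (color fe∈j)
        (compatible-< H f S compat e (p─q⊆p (vertices H e) ⁅ lookup f e ⁆ v∈e-fe)
          (x∈p-y⇒x≢y (vertices H e) v∈e-fe)))
    fits : ∀ v → Fits P ks v (lookup S v)
    -- A vertex of P̃ᵢ shares an edge `e` with some f(e) in Pᵢ and, lying outside f(H), differs from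
    -- f(e); so its color is strictly smaller.
    fits v = (λ i → color) , λ i v∈P̃ →
      let (e , fe∈i , v∈e) , v∉im , _ = tildes-sound [] P i v∈P̃ in
      subst (lookup S v Fin.<_) (color fe∈i)
        (compatible-< H f S compat e v∈e λ v≡fe → v∉im (subst (_∈ I) (sym v≡fe) (∈-image⁺ e)))

  -- Each summand of `F`, multiplied by the power of `n`, counts the colorings realizing one cell.
  -- After exchanging sums, a coloring realizes one cell if it is compatible and none otherwise.
  #compatible : IsOrientation H f → (n : ℕ) →
    n ^ ∣ isolated H ∣ * ∑ (compatibleCompositions H f) (λ (_ , P) → F (exponents H f P) n) ≡
    ∑ (colorings m n) (⟦_⟧ ∘ strictlyCompatible? H f)
  #compatible orient n = begin
    N * ∑ Ps (λ (_ , P) → F (exponents H f P) n)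
      ≡⟨ *-distribˡ-∑ N Ps _ ⟩
    ∑ Ps (λ (_ , P) → N * F (exponents H f P) n)
      ≡⟨ ∑-cong Ps (λ {(l , P)} P∈ → trans (*-distribˡ-∑ N (sequences n l) _)
           (trans (∑-cong (sequences n l) λ {ks} _ → #fitting orient P ks (proj₁ (∈-compatibleCompositions⁻ P∈)))
                  (sym (∑-map (λ ks → l , P , ks) (sequences n l) _)))) ⟩
    ∑ Ps (λ (l , P) → ∑ (map (λ ks → l , P , ks) (sequences n l)) (λ c → ∑ Ss (λ S → ⟦ realizes? S c ⟧)))
      ≡⟨ ∑-concatMap _ Ps _ ⟨
    ∑ (cells n) (λ c → ∑ Ss (λ S → ⟦ realizes? S c ⟧))
      ≡⟨ ∑-comm (cells n) Ss (λ c S → ⟦ realizes? S c ⟧) ⟩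
    ∑ Ss (λ S → ∑ (cells n) (λ c → ⟦ realizes? S c ⟧))
      ≡⟨ ∑-cong Ss (λ {S} _ → ∑-unique (λ c → realizes? S c) (strictlyCompatible? H f S) (cells-unique n)
           (compatible⇒cell S)
           (λ c∈ fits → let comp , respects , inc = ∈-cells⁻ c∈ in
             fits⇒compatible orient S comp respects inc fits)
           (cell-unique S)) ⟩
    ∑ Ss (⟦_⟧ ∘ strictlyCompatible? H f) ∎
    where
    open ≡-Reasoning
    N = n ^ ∣ isolated H ∣
    Ps = compatibleCompositions H f
    Ss = colorings m n

theorem11 : {m : ℕ} (H : Hypergraph {m} ⊤) (n : ℕ) →
    (χ H n ≡ length (filter (hasUniqueMaxima? H) (colorings m n)))
    × (χ H n ≡ length (filter (λ (f , S) → strictlyCompatible? H f S) (cartesianProduct (acyclicOrientations H) (colorings m n))))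
    × (χ H n ≡ n ^ ∣ isolated H ∣ * sum (map (λ f → sum (map (λ (_ , P) → F (exponents H f P) n) (compatibleCompositions H f))) (acyclicOrientations H)))
theorem11 {m} H n =
  trans (χ≡#uniqueMaxima H n) (sym (length-filter (hasUniqueMaxima? H) Ss)) ,
  trans χ≡#compatible (sym (trans (length-filter (λ (f , S) → strictlyCompatible? H f S) (cartesianProduct As Ss))
    (∑-cartesianProductWith _,_ As Ss _))) ,
  trans χ≡#compatible (sym (trans (*-distribˡ-∑ (n ^ ∣ isolated H ∣) As _)
    (∑-cong As λ {f} f∈ → #compatible H f (∈-acyclicOrientations⁻ H f∈) n)))
  where
  As = acyclicOrientations H
  Ss = colorings m n
  -- Shared by (2) and (3): the double sum is the count of pairs, and `#compatible` evaluates its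
  -- inner sum.
  χ≡#compatible : χ H n ≡ ∑ As (λ f → ∑ Ss (⟦_⟧ ∘ strictlyCompatible? H f))
  χ≡#compatible = trans (χ≡#uniqueMaxima H n) (#uniqueMaxima≡#compatible H n)
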